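{- There is a function $f:\mathbb{N}\to\mathbb{R}$ with $f(n)\to 0$ as $n\to\infty$ such that every connected vertex transitive (finite, simple) graph on $n \ge 3$ vertices contains a cycle of length at least $(1 - f(n))\, n^{3/5}$.
   Context: A graph is vertex transitive if its automorphism group acts transitively on its vertex set. The length of a cycle is its number of vertices (equivalently, edges). -}

module Defs where

open import Data.Nat using (ℕ; suc; _≤_; _∸_; _*_; _^_)
open import Data.Fin using (Fin; toℕ)
open import Data.Fin.Permutation using (Permutation′; _⟨$⟩ʳ_)
open import Data.Bool using (Bool; true; false)
open import Data.Product using (∃-syntax; _×_)
open import Relation.Binary.PropositionalEquality using (_≡_)
open import Relation.Binary.Construct.Closure.ReflexiveTransitive using (Star)
open import Function.Definitions using (Injective)

record Graph (n : ℕ) : Set where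
  field
    adj     : Fin n → Fin n → Bool
    symm    : ∀ i j → adj i j ≡ adj j i
    irrefl  : ∀ i → adj i i ≡ false

open Graph public

Edge : ∀ {n} → Graph n → Fin n → Fin n → Set
Edge G i j = adj G i j ≡ true

Connected : ∀ {n} → Graph n → Set
Connected {n} G = ∀ (u v : Fin n) → Star (Edge G) u v

IsAutomorphism : ∀ {n} → Graph n → Permutation′ n → Set
IsAutomorphism {n} G σ =
  ∀ (i j : Fin n) → adj G (σ ⟨$⟩ʳ i) (σ ⟨$⟩ʳ j) ≡ adj G i j

VertexTransitive : ∀ {n} → Graph n → Set
VertexTransitive {n} G =
  ∀ (u v : Fin n) → ∃[ σ ] (IsAutomorphism G σ × (σ ⟨$⟩ʳ u ≡ v))

record Cycle {n : ℕ} (G : Graph n) (L : ℕ) : Set where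
  field
    len≥3 : 3 ≤ L
    vert  : Fin L → Fin n
    inj   : Injective _≡_ _≡_ vert
    step  : ∀ (i j : Fin L) → suc (toℕ i) ≡ toℕ j → Edge G (vert i) (vert j)
    close : ∀ (i j : Fin L) → suc (toℕ i) ≡ L → toℕ j ≡ 0 → Edge G (vert i) (vert j)

{-# OPTIONS --safe #-}

-- Let C be a cycle of length L in G. Averaging over the automorphism group gives a translate
-- D of C meeting C in m ≤ L² / n vertices. These vertices cut C and D into at most m + 1
-- segments each. By Menger's theorem either there are more than m + (m + 1)² disjoint
-- C–D paths, or some set S of at most that size separates C from D. In the first case two of
-- the paths join the same segment of C to the same segment of D, and exchanging the two
-- segments between them yields a cycle longer than C. For m = 0 the second case makes G have
-- a cut vertex, which transitivity forbids, so two disjoint cycles of length L always yield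
-- a longer one. If |S| L < n, averaging again gives a translate of C that misses S; being
-- connected in G − S it misses C or D, and again there is a longer cycle. So a longest cycle
-- satisfies n ≤ (m + (m + 1)²) L with m ≤ L² / n, that is, L⁵ ≥ (1 − o(1)) n³.

module Submission where

open import Defs
open import Data.Bool using (true; if_then_else_)
open import Data.Bool.Properties using () renaming (_≟_ to _≟ᵇ_)
open import Data.Empty using (⊥; ⊥-elim)
open import Data.Fin using (Fin; zero; suc; toℕ; fromℕ<; punchOut; combine; join; splitAt)
open import Data.Fin.Permutation using (Permutation′; _⟨$⟩ʳ_; _⟨$⟩ˡ_; inverseˡ; inverseʳ)
open import Data.Fin.Properties
  using (_≟_; any?; all?; ¬∀⟶∃¬; injective⇒≤; pigeonhole; punchOut-injective; splitAt-join; combine-injective;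
         toℕ<n; toℕ-fromℕ<; toℕ-injective; fromℕ<-injective)
  renaming (<⇒≢ to <⇒≢ᶠ)
open import Data.List using (List; []; _∷_; _++_; _∷ʳ_; length; lookup; filter; cartesianProduct; allFin)
open import Data.List.Membership.DecPropositional using () renaming (_∈?_ to member?)
open import Data.List.Membership.Propositional using (_∈_)
open import Data.List.Membership.Propositional.Properties
  using (∈-++⁻; ∈-lookup; ∈-filter⁺; ∈-filter⁻; ∈-cartesianProduct⁺; ∈-allFin)
open import Data.List.Properties using (length-++)
open import Data.List.Relation.Binary.Permutation.Propositional using (_↭_; ↭-refl; ↭-trans; prep; swap)
open import Data.List.Relation.Binary.Permutation.Propositional.Properties using (All-resp-↭; ↭-length; ∷↭∷ʳ)
open import Data.List.Relation.Unary.All as All using (All; []; _∷_)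
open import Data.List.Relation.Unary.All.Properties using (¬Any⇒All¬)
open import Data.List.Relation.Unary.AllPairs using ([]; _∷_)
open import Data.List.Relation.Unary.Any using (here; there)
open import Data.List.Relation.Unary.Unique.Propositional using (Unique)
open import Data.List.Relation.Unary.Unique.Propositional.Properties using (++⁺; Unique[x∷xs]⇒x∉xs)
open import Data.Nat as ℕ
  using (ℕ; zero; suc; _+_; _*_; _∸_; _^_; _/_; _%_; _≤_; _<_; z≤n; s≤s; NonZero; >-nonZero)
open import Data.Nat.DivMod
  using (m%n<n; m≡m%n+[m/n]*n; [m+kn]%n≡m%n; [m+n]%n≡m%n; m<n⇒m%n≡m; n%n≡0; /-monoˡ-≤)
open import Data.Nat.Properties hiding (_≟_)
open import Data.Nat.Solver using (module +-*-Solver)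
open import Data.Product using (Σ; ∃; ∃₂; ∃-syntax; _×_; _,_; proj₁; proj₂)
open import Data.Sum as Sum using (_⊎_; inj₁; inj₂; [_,_]′)
open import Data.Sum.Properties using (inj₁-injective; inj₂-injective)
open import Data.Vec as Vec using (Vec; []; _∷_)
open import Data.Vec.Properties using (lookup-map; lookup∘tabulate)
open import Function using (_∘_; id; _⇔_; mk⇔; module Equivalence)
open import Function.Definitions using (Injective)
open import Relation.Binary.Construct.Closure.ReflexiveTransitive using (Star; ε; _◅_)
open import Relation.Binary.Definitions using (tri<; tri≈; tri>)
open import Relation.Binary.PropositionalEquality
  using (_≡_; _≢_; refl; sym; trans; cong; cong₂; subst; subst₂; ≢-sym; module ≡-Reasoning)
open import Relation.Nullary using (¬_; Dec; yes; no; does; contradiction)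
open import Relation.Nullary.Decidable using (_×-dec_; _→-dec_; ¬?; does-⇔; decidable-stable)
open import Relation.Unary using (Decidable; ∁; _⊆_)
open import Algebra.Properties.Semiring.Sum +-*-semiring
  using (sum; sum-cong-≗; sum-permute; ∑-comm; *-distribˡ-sum; *-distribʳ-sum; sum-replicate-zero)

private variable
  V : Set
  R R' : V → V → Set
  P Q S : V → Set
  a b c u v w x : V
  xs ys : List V
  n k p q : ℕ

-- Walks and separators

-- Both ends satisfy `P` as well. A complement as `P` expresses avoidance of a separator; a set of
-- used vertices as `P` confines a walk of a linkage.
data Walk {V : Set} (R : V → V → Set) (P : V → Set) : V → V → Set where
  stay : P a → Walk R P a a
  go : P a → R a b → Walk R P b c → Walk R P a c

start∈ : Walk R P a b → P a
start∈ (stay p)     = p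
start∈ (go p _ _) = p

end∈ : Walk R P a b → P b
end∈ (stay p)     = p
end∈ (go _ _ w) = end∈ w

map-walk : (∀ {u v} → R u v → R' u v) → P ⊆ Q → Walk R P a b → Walk R' Q a b
map-walk f g (stay p)     = stay (g p)
map-walk f g (go p r w) = go (g p) (f r) (map-walk f g w)

infixr 5 _▷_
_▷_ : Walk R P a b → Walk R P b c → Walk R P a c
stay _     ▷ w' = w'
go p r w ▷ w' = go p r (w ▷ w')

-- Stopping at the first vertex of `S` makes every earlier vertex reachable from `a` off `S`. The
-- walk carries these certificates along because `glue` plays them against separation.
first-hit : Decidable S → Walk R P a b →
  ∃[ c ] ((c ≡ b ⊎ S c) × Walk R (λ v → P v × (Walk R (∁ S) a v ⊎ S v)) a c)
first-hit S? (stay {a} p) with S? a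
... | yes s = a , inj₁ refl , stay (p , inj₂ s)
... | no ¬s = a , inj₁ refl , stay (p , inj₁ (stay ¬s))
first-hit S? (go {a} p r w) with S? a
... | yes s = a , inj₂ s , stay (p , inj₂ s)
... | no ¬s with first-hit S? w
...   | c , h , w' = c , h , go (p , inj₁ (stay ¬s)) r
                       (map-walk id (λ { (q , x) → q , Sum.map₁ (go ¬s r) x }) w')

last-hit : Decidable S → Walk R P a b →
  ∃[ c ] ((c ≡ a ⊎ S c) × Walk R (λ v → P v × (Walk R (∁ S) v b ⊎ S v)) c b)
last-hit S? (stay {a} p) with S? a
... | yes s = a , inj₁ refl , stay (p , inj₂ s)
... | no ¬s = a , inj₁ refl , stay (p , inj₁ (stay ¬s))
last-hit {S = S} {R = R} S? (go {a} {b} {z} p r w) with last-hit S? w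
... | c , inj₂ s , w' = c , inj₂ s , w'
... | .b , inj₁ refl , w' with S? b
...   | yes s = b , inj₂ s , w'
...   | no ¬b = a , inj₁ refl , go (p , from (S? a)) r w'
  where
  from : Dec (S a) → Walk R (∁ S) a z ⊎ S a
  from (yes s) = inj₂ s
  -- Here the tail was kept whole and its first vertex `b` is off `S`, so the certificate of `b` is
  -- a walk to `z` off `S`.
  from (no ¬s) = inj₁ (go ¬s r ([ id , ⊥-elim ∘ ¬b ]′ (proj₂ (start∈ w'))))

Image : (Fin k → V) → V → Set
Image f v = ∃[ i ] v ≡ f i

image? : (f : Fin k → Fin n) → Decidable (Image f)
image? f v = any? (λ i → v ≟ f i)

infixr 5 _◂_
_◂_ : V → (Fin k → V) → Fin (suc k) → V
(x ◂ f) zero    = x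
(x ◂ f) (suc i) = f i

◂-injective : {f : Fin k → V} → Injective _≡_ _≡_ f → ¬ Image f a → Injective _≡_ _≡_ (a ◂ f)
◂-injective f-inj a∉f {zero}  {zero}  _  = refl
◂-injective f-inj a∉f {zero}  {suc j} eq = ⊥-elim (a∉f (j , eq))
◂-injective f-inj a∉f {suc i} {zero}  eq = ⊥-elim (a∉f (i , sym eq))
◂-injective f-inj a∉f {suc i} {suc j} eq = cong suc (f-inj eq)

-- Punching out a missed value would inject `Fin (suc k)` into `Fin k`.
injective⇒surjective : (f : Fin k → Fin k) → Injective _≡_ _≡_ f → ∀ j → ∃[ i ] f i ≡ j
injective⇒surjective {suc k} f f-inj j with any? (λ i → f i ≟ j)
... | yes hit = hit
... | no miss = ⊥-elim (1+n≰n (injective⇒≤ {f = λ i → punchOut (miss' i)}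
                  (λ {i} {i'} → f-inj ∘ punchOut-injective (miss' i) (miss' i'))))
  where
  miss' : ∀ i → j ≢ f i
  miss' i = miss ∘ (i ,_) ∘ sym

-- The case of no arcs in Menger's theorem. The vertex `v₀` only pads a cover up to exactly `k`
-- entries.
select-or-cover : {P : Fin n → Set} → Decidable P → Fin n → ∀ k →
  (∃[ f ] (Injective _≡_ _≡_ f × ∀ (i : Fin (suc k)) → P (f i))) ⊎
  (Σ (Fin k → Fin n) λ f → P ⊆ Image f)
select-or-cover P? v₀ zero with any? P?
... | yes (v , p) = inj₁ ((λ _ → v) , (λ { {zero} {zero} _ → refl }) , (λ _ → p))
... | no ¬p       = inj₂ ((λ ()) , (λ {v} p → ⊥-elim (¬p (v , p))))
select-or-cover P? v₀ (suc k) with select-or-cover P? v₀ k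
... | inj₂ (f , cover) = inj₂ (v₀ ◂ f , λ p → let i , eq = cover p in suc i , eq)
... | inj₁ (f , f-inj , f∈) with any? (λ v → P? v ×-dec ¬? (image? f v))
...   | yes (v , p , v∉f) =
        inj₁ (v ◂ f , ◂-injective f-inj v∉f , λ { zero → p ; (suc i) → f∈ i })
...   | no none = inj₂ (f , λ {v} p → decidable-stable (image? f v) (λ v∉f → none (v , p , v∉f)))

-- Menger's theorem

Arcs : List (V × V) → V → V → Set
Arcs E u v = (u , v) ∈ E

-- A vertex of both `A` and `B` is a one-vertex walk, so it has to lie in `S`. Repetitions in `S`
-- are allowed, hence "at most `k` vertices".
Separates : {V : Set} (R : V → V → Set) (A B : V → Set) → (Fin k → V) → Set
Separates R A B S = ∀ {a b} → A a → B b → ¬ Walk R (∁ (Image S)) a b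

-- Disjointness is asked of the sets in which the walks run. The walks may repeat vertices and need
-- not be pruned to paths.
record Linkage {V : Set} (R : V → V → Set) (A B : V → Set) (k : ℕ) : Set₁ where
  field
    Uses     : Fin k → V → Set
    disjoint : ∀ {i j v} → Uses i v → Uses j v → i ≡ j
    src tgt  : Fin k → V
    src∈     : ∀ i → A (src i)
    tgt∈     : ∀ i → B (tgt i)
    walk     : ∀ i → Walk R (Uses i) (src i) (tgt i)

-- Linkages to and from T = x ◂ S, indexed by their end points in T; each walk is cut at its
-- first (for Leaving: last) vertex in S = T ∘ suc, which is what near records.
record Reaching {V : Set} (R : V → V → Set) (A : V → Set) (T : Fin (suc k) → V) : Set₁ where
  field
    Uses     : Fin (suc k) → V → Set
    disjoint : ∀ {i j v} → Uses i v → Uses j v → i ≡ j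
    src      : Fin (suc k) → V
    src∈     : ∀ i → A (src i)
    walk     : ∀ i → Walk R (Uses i) (src i) (T i)
    near     : ∀ {i v} → Uses i v → Walk R (∁ (Image (T ∘ suc))) (src i) v ⊎ Image (T ∘ suc) v

record Leaving {V : Set} (R : V → V → Set) (T : Fin (suc k) → V) (B : V → Set) : Set₁ where
  field
    Uses     : Fin (suc k) → V → Set
    disjoint : ∀ {i j v} → Uses i v → Uses j v → i ≡ j
    tgt      : Fin (suc k) → V
    tgt∈     : ∀ i → B (tgt i)
    walk     : ∀ i → Walk R (Uses i) (T i) (tgt i)
    near     : ∀ {i v} → Uses i v → Walk R (∁ (Image (T ∘ suc))) v (tgt i) ⊎ Image (T ∘ suc) v

-- Disjoint walks have distinct end points, so `k` of them ending in a `k`-tuple `T` occupy every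
-- position once. Inverting this bijection lets the walks be numbered by `T`.
module Transversal {V : Set} (T : Fin k → V) (Uses : Fin k → V → Set)
  (disjoint : ∀ {i j v} → Uses i v → Uses j v → i ≡ j)
  (point : Fin k → V) (point∈ : ∀ i → Uses i (point i)) (point∈T : ∀ i → Image T (point i)) where

  private
    position : Fin k → Fin k
    position i = proj₁ (point∈T i)

    position-injective : Injective _≡_ _≡_ position
    position-injective {i} {j} eq = disjoint (point∈ i)
      (subst (Uses j) (trans (proj₂ (point∈T j)) (trans (cong T (sym eq)) (sym (proj₂ (point∈T i))))) (point∈ j))

    preimage : ∀ i → ∃[ j ] position j ≡ i
    preimage = injective⇒surjective position position-injective

  index : Fin k → Fin k
  index i = proj₁ (preimage i)

  point-index : ∀ i → point (index i) ≡ T i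
  point-index i = trans (proj₂ (point∈T (index i))) (cong T (proj₂ (preimage i)))

  index-injective : Injective _≡_ _≡_ index
  index-injective {i} {j} eq =
    trans (sym (proj₂ (preimage i))) (trans (cong position eq) (proj₂ (preimage j)))

module _ {R : Fin n → Fin n → Set} {T : Fin (suc k) → Fin n} where

  reaching : {A : Fin n → Set} → Linkage R A (Image T) (suc k) → Reaching R A T
  reaching L = record
    { Uses     = λ i → proj₁ (trimmed i)
    ; disjoint = λ {i} {j} {v} u u' → index-injective
        (disjoint {v = v} (proj₁ (proj₂ (proj₂ (trimmed i))) u) (proj₁ (proj₂ (proj₂ (trimmed j))) u'))
    ; src      = src ∘ index
    ; src∈     = src∈ ∘ index
    ; walk     = λ i → proj₁ (proj₂ (trimmed i))
    ; near     = λ {i} → proj₂ (proj₂ (proj₂ (trimmed i)))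
    }
    where
    open Linkage L
    open Transversal T Uses disjoint tgt (end∈ ∘ walk) tgt∈
    walk' : ∀ i → Walk R (Uses (index i)) (src (index i)) (T i)
    walk' i = subst (Walk R (Uses (index i)) (src (index i))) (point-index i) (walk (index i))
    trimmed : ∀ i → ∃[ U ] (Walk R U (src (index i)) (T i) × U ⊆ Uses (index i) ×
      (U ⊆ λ v → Walk R (∁ (Image (T ∘ suc))) (src (index i)) v ⊎ Image (T ∘ suc) v))
    trimmed i with first-hit (image? (T ∘ suc)) (walk' i)
    ... | _ , inj₁ refl , w = _ , w , proj₁ , proj₂
    -- The cut vertex is `T (suc l)`, where walk `suc l` ends. By disjointness this is walk `i`
    -- itself, so the cut walk still ends at `T i`.
    ... | _ , inj₂ (l , refl) , w
      with index-injective (disjoint (end∈ (walk' (suc l))) (proj₁ (end∈ w)))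
    ...   | refl = _ , w , proj₁ , proj₂

  leaving : {A : Fin n → Set} → Linkage R (Image T) A (suc k) → Leaving R T A
  leaving L = record
    { Uses     = λ i → proj₁ (trimmed i)
    ; disjoint = λ {i} {j} {v} u u' → index-injective
        (disjoint {v = v} (proj₁ (proj₂ (proj₂ (trimmed i))) u) (proj₁ (proj₂ (proj₂ (trimmed j))) u'))
    ; tgt      = tgt ∘ index
    ; tgt∈     = tgt∈ ∘ index
    ; walk     = λ i → proj₁ (proj₂ (trimmed i))
    ; near     = λ {i} → proj₂ (proj₂ (proj₂ (trimmed i)))
    }
    where
    open Linkage L
    open Transversal T Uses disjoint src (start∈ ∘ walk) src∈
    walk' : ∀ i → Walk R (Uses (index i)) (T i) (tgt (index i))
    walk' i = subst (λ s → Walk R (Uses (index i)) s (tgt (index i))) (point-index i) (walk (index i))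
    trimmed : ∀ i → ∃[ U ] (Walk R U (T i) (tgt (index i)) × U ⊆ Uses (index i) ×
      (U ⊆ λ v → Walk R (∁ (Image (T ∘ suc))) v (tgt (index i)) ⊎ Image (T ∘ suc) v))
    trimmed i with last-hit (image? (T ∘ suc)) (walk' i)
    ... | _ , inj₁ refl , w = _ , w , proj₁ , proj₂
    ... | _ , inj₂ (l , refl) , w
      with index-injective (disjoint (start∈ (walk' (suc l))) (proj₁ (start∈ w)))
    ...   | refl = _ , w , proj₁ , proj₂

module _ {n : ℕ} {x y : Fin n} {E : List (Fin n × Fin n)} where

  before-arc : ∀ {P a b} → Walk (Arcs ((x , y) ∷ E)) P a b → Walk (Arcs E) P a b ⊎ Walk (Arcs E) P a x
  before-arc (stay p)                 = inj₁ (stay p)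
  before-arc (go p (here refl) w)   = inj₂ (stay p)
  before-arc (go p (there e) w)     = Sum.map (go p e) (go p e) (before-arc w)

  after-arc : ∀ {P a b} → Walk (Arcs ((x , y) ∷ E)) P a b → Walk (Arcs E) P a b ⊎ Walk (Arcs E) P y b
  after-arc (stay p)                 = inj₁ (stay p)
  after-arc (go p (here refl) w)   = inj₂ ([ id , id ]′ (after-arc w))
  after-arc (go p (there e) w)     = Sum.map₁ (go p e) (after-arc w)

  module _ {A B : Fin n → Set} {S : Fin k → Fin n} (S-sep : Separates (Arcs E) A B S) where

    -- A walk that takes the arc reaches `x` before doing so; one that does not take it must meet
    -- `S`. Either way its beginning runs from `A` to the image of `x ◂ S` and so meets `T`.
    separates-source : {T : Fin k → Fin n} → Separates (Arcs E) A (Image (x ◂ S)) T →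
      Separates (Arcs ((x , y) ∷ E)) A B T
    separates-source T-sep a∈ b∈ w with before-arc w
    ... | inj₂ w' = T-sep a∈ (zero , refl) w'
    ... | inj₁ w' with first-hit (image? S) w'
    ...   | _ , inj₂ (l , eq) , w'' = T-sep a∈ (suc l , eq) (map-walk id proj₁ w'')
    ...   | _ , inj₁ refl , w'' with proj₂ (end∈ w'')
    ...     | inj₁ avoiding = S-sep a∈ b∈ avoiding
    ...     | inj₂ (l , eq) = T-sep a∈ (suc l , eq) (map-walk id proj₁ w'')

    separates-target : {T : Fin k → Fin n} → Separates (Arcs E) (Image (y ◂ S)) B T →
      Separates (Arcs ((x , y) ∷ E)) A B T
    separates-target T-sep a∈ b∈ w with after-arc w
    ... | inj₂ w' = T-sep (zero , refl) b∈ w'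
    ... | inj₁ w' with last-hit (image? S) w'
    ...   | _ , inj₂ (l , eq) , w'' = T-sep (suc l , eq) b∈ (map-walk id proj₁ w'')
    ...   | _ , inj₁ refl , w'' with proj₂ (start∈ w'')
    ...     | inj₁ avoiding = S-sep a∈ b∈ avoiding
    ...     | inj₂ (l , eq) = T-sep (suc l , eq) b∈ (map-walk id proj₁ w'')

    -- Walks number zero are joined by the new arc, walks `suc l` at `S l`. A vertex shared by walks
    -- of `α` and `β` lies in `S`, else their certificates would join `A` to `B` off `S`; and at
    -- `S l` both walks have number `suc l`.
    glue : Reaching (Arcs E) A (x ◂ S) → Leaving (Arcs E) (y ◂ S) B →
      Linkage (Arcs ((x , y) ∷ E)) A B (suc k)
    glue α β = record
      { Uses     = λ i v → α.Uses i v ⊎ β.Uses i v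
      ; disjoint = λ { (inj₁ u) (inj₁ u') → α.disjoint u u'
                     ; (inj₁ u) (inj₂ u') → meet u u'
                     ; (inj₂ u) (inj₁ u') → sym (meet u' u)
                     ; (inj₂ u) (inj₂ u') → β.disjoint u u' }
      ; src      = α.src
      ; tgt      = β.tgt
      ; src∈     = α.src∈
      ; tgt∈     = β.tgt∈
      ; walk     = λ { zero    → α-walk zero ▷ go (inj₁ (end∈ (α.walk zero))) (here refl) (β-walk zero)
                     ; (suc l) → α-walk (suc l) ▷ β-walk (suc l) }
      }
      where
      module α = Reaching α
      module β = Leaving β
      at-S : ∀ l {i j} → α.Uses i (S l) → β.Uses j (S l) → i ≡ j
      at-S l u u' = trans (α.disjoint u (end∈ (α.walk (suc l)))) (β.disjoint (start∈ (β.walk (suc l))) u')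
      meet : ∀ {i j v} → α.Uses i v → β.Uses j v → i ≡ j
      meet {i} {j} u u' with α.near u | β.near u'
      ... | inj₁ w | inj₁ w' = ⊥-elim (S-sep (α.src∈ i) (β.tgt∈ j) (w ▷ w'))
      ... | inj₂ (l , refl) | _      = at-S l u u'
      ... | inj₁ _ | inj₂ (l , refl) = at-S l u u'
      α-walk : ∀ i → Walk (Arcs ((x , y) ∷ E)) (λ v → α.Uses i v ⊎ β.Uses i v) (α.src i) ((x ◂ S) i)
      α-walk i = map-walk there inj₁ (α.walk i)
      β-walk : ∀ i → Walk (Arcs ((x , y) ∷ E)) (λ v → α.Uses i v ⊎ β.Uses i v) ((y ◂ S) i) (β.tgt i)
      β-walk i = map-walk there inj₂ (β.walk i)

-- Göring's induction on the arcs: if S separates once the arc x → y is removed,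
-- then linkages from A to S ∪ {x} and from S ∪ {y} to B can be glued along S and the arc.
menger : (E : List (Fin n × Fin n)) {A B : Fin n → Set} → Decidable A → Decidable B → Fin n → ∀ k →
  Linkage (Arcs E) A B (suc k) ⊎ (Σ (Fin k → Fin n) (Separates (Arcs E) A B))
menger [] A? B? v₀ k with select-or-cover (λ v → A? v ×-dec B? v) v₀ k
... | inj₁ (f , f-inj , f∈) = inj₁ (record
  { Uses     = λ i v → v ≡ f i
  ; disjoint = λ eq eq' → f-inj (trans (sym eq) eq')
  ; src      = f
  ; tgt      = f
  ; src∈     = proj₁ ∘ f∈
  ; tgt∈     = proj₂ ∘ f∈
  ; walk     = λ i → stay refl
  })
... | inj₂ (S , cover) = inj₂ (S , λ { a∈ b∈ (stay a∉S) → a∉S (cover (a∈ , b∈)) })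
menger ((x , y) ∷ E) A? B? v₀ k with menger E A? B? v₀ k
... | inj₁ L = inj₁ (record
  { Uses     = Uses L ; disjoint = disjoint L ; src = src L ; tgt = tgt L
  ; src∈ = src∈ L ; tgt∈ = tgt∈ L ; walk = λ i → map-walk there id (walk L i) })
  where open Linkage
... | inj₂ (S , S-sep) with menger E A? (image? (x ◂ S)) v₀ k | menger E (image? (y ◂ S)) B? v₀ k
...   | inj₂ (T , T-sep) | _                = inj₂ (T , separates-source S-sep T-sep)
...   | inj₁ _           | inj₂ (T , T-sep) = inj₂ (T , separates-target S-sep T-sep)
...   | inj₁ α           | inj₁ β           = inj₁ (glue S-sep (reaching α) (leaving β))

-- Sums over automorphisms

𝟙 : {A : Set} → Dec A → ℕ
𝟙 a? = if does a? then 1 else 0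

𝟙-⇔ : {A B : Set} → A ⇔ B → (a? : Dec A) (b? : Dec B) → 𝟙 a? ≡ 𝟙 b?
𝟙-⇔ A⇔B a? b? = cong (λ b → if b then 1 else 0) (does-⇔ A⇔B a? b?)

𝟙-true : {A : Set} (a? : Dec A) → A → 𝟙 a? ≡ 1
𝟙-true (yes _) _ = refl
𝟙-true (no ¬a) a with () ← ¬a a

-- With weight 0 both sides vanish, so strictness itself proves `A`.
𝟙-weighted : {A : Set} (a? : Dec A) {x y : ℕ} → 𝟙 a? * x * n < 𝟙 a? * suc y → A × x * n ≤ y
𝟙-weighted {n} (yes a) {x} {y} lt
  with s≤s le ← subst (1 * x * n <_) (+-identityʳ (suc y)) lt = a , subst (λ z → z * n ≤ y) (+-identityʳ x) le

sum-const : ∀ n c → sum {n} (λ _ → c) ≡ n * c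
sum-const zero    c = refl
sum-const (suc n) c = cong (c +_) (sum-const n c)

sum-𝟙≡1 : (i : Fin n) → sum (λ j → 𝟙 (i ≟ j)) ≡ 1
sum-𝟙≡1 {suc n} zero    = cong suc (sum-replicate-zero n)
sum-𝟙≡1 {suc n} (suc i) = sum-𝟙≡1 i

sum-<⇒∃< : (f g : Fin n → ℕ) → sum f < sum g → ∃[ i ] f i < g i
sum-<⇒∃< {suc n} f g lt with f zero <? g zero
... | yes lt₀ = zero , lt₀
... | no ≮₀ with sum (f ∘ suc) <? sum (g ∘ suc)
...   | yes lt' = let i , h = sum-<⇒∃< (f ∘ suc) (g ∘ suc) lt' in suc i , h
...   | no ≮'  with () ← <⇒≱ lt (+-mono-≤ (≮⇒≥ ≮₀) (≮⇒≥ ≮'))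

0<sum⇒∃0< : (f : Fin n → ℕ) → 0 < sum f → ∃[ i ] 0 < f i
0<sum⇒∃0< {n} f 0<sum = sum-<⇒∃< (λ _ → 0) f (subst (_< sum f) (sym (sum-replicate-zero n)) 0<sum)

f≤sum : (f : Fin n → ℕ) (i : Fin n) → f i ≤ sum f
f≤sum f zero    = m≤m+n _ _
f≤sum f (suc i) = ≤-trans (f≤sum (f ∘ suc) i) (m≤n+m _ _)

sum-mono : {f g : Fin n → ℕ} → (∀ i → f i ≤ g i) → sum f ≤ sum g
sum-mono {zero}  h = z≤n
sum-mono {suc n} h = +-mono-≤ (h zero) (sum-mono (h ∘ suc))

-- Self-maps of the vertex set are summed over as vectors of values. With the weight `autWeight`
-- this sums over the automorphism group without listing it.
sumVec : ∀ k → (Vec (Fin n) k → ℕ) → ℕ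
sumVec zero    F = F []
sumVec (suc k) F = sum (λ x → sumVec k (F ∘ (x ∷_)))

sumVec-cong : ∀ k {F H : Vec (Fin n) k → ℕ} → (∀ f → F f ≡ H f) → sumVec k F ≡ sumVec k H
sumVec-cong zero    eq = eq []
sumVec-cong (suc k) eq = sum-cong-≗ (λ x → sumVec-cong k (eq ∘ (x ∷_)))

sumVec-permute : ∀ k (F : Vec (Fin n) k → ℕ) (π : Permutation′ n) →
  sumVec k F ≡ sumVec k (F ∘ Vec.map (π ⟨$⟩ʳ_))
sumVec-permute zero    F π = refl
sumVec-permute (suc k) F π = trans
  (sum-cong-≗ (λ x → sumVec-permute k (F ∘ (x ∷_)) π))
  (sum-permute (λ x → sumVec k (F ∘ (x ∷_) ∘ Vec.map (π ⟨$⟩ʳ_))) π)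

sumVec-sum : ∀ k (F : Vec (Fin n) k → Fin p → ℕ) →
  sumVec k (sum ∘ F) ≡ sum (λ i → sumVec k (λ f → F f i))
sumVec-sum zero    F = refl
sumVec-sum (suc k) F = trans
  (sum-cong-≗ (λ x → sumVec-sum k (F ∘ (x ∷_))))
  (∑-comm (λ x i → sumVec k (λ f → F (x ∷ f) i)))

sumVec-*ʳ : ∀ k (F : Vec (Fin n) k → ℕ) c → sumVec k F * c ≡ sumVec k (λ f → F f * c)
sumVec-*ʳ zero    F c = refl
sumVec-*ʳ (suc k) F c = trans (*-distribʳ-sum c (λ x → sumVec k (F ∘ (x ∷_))))
  (sum-cong-≗ (λ x → sumVec-*ʳ k (F ∘ (x ∷_)) c))

sumVec-<⇒∃< : ∀ k (F H : Vec (Fin n) k → ℕ) → sumVec k F < sumVec k H → ∃[ f ] F f < H f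
sumVec-<⇒∃< zero    F H lt = [] , lt
sumVec-<⇒∃< (suc k) F H lt with sum-<⇒∃< _ _ lt
... | x , lt' with sumVec-<⇒∃< k (F ∘ (x ∷_)) (H ∘ (x ∷_)) lt'
...   | f , h = x ∷ f , h

F≤sumVec : ∀ k (F : Vec (Fin n) k → ℕ) f → F f ≤ sumVec k F
F≤sumVec zero    F []      = ≤-refl
F≤sumVec (suc k) F (x ∷ f) = ≤-trans (F≤sumVec k (F ∘ (x ∷_)) f) (f≤sum (λ y → sumVec k (F ∘ (y ∷_))) x)

module _ {n : ℕ} (G : Graph n) where

  -- On a finite vertex set injectivity already gives bijectivity, so no inverse is carried and the
  -- property is decidable.
  IsAut : (Fin n → Fin n) → Set
  IsAut g = (∀ i j → g i ≡ g j → i ≡ j) × (∀ i j → adj G (g i) (g j) ≡ adj G i j)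

  isAut? : ∀ g → Dec (IsAut g)
  isAut? g = all? (λ i → all? (λ j → (g i ≟ g j) →-dec (i ≟ j)))
       ×-dec all? (λ i → all? (λ j → adj G (g i) (g j) ≟ᵇ adj G i j))

  isAut-cong : ∀ {g h} → (∀ i → g i ≡ h i) → IsAut g → IsAut h
  isAut-cong eq (inj , pres) =
    (λ i j e → inj i j (trans (eq i) (trans e (sym (eq j))))) ,
    (λ i j → trans (cong₂ (adj G) (sym (eq i)) (sym (eq j))) (pres i j))

  autWeight : Vec (Fin n) n → ℕ
  autWeight f = 𝟙 (isAut? (Vec.lookup f))

  module _ {π : Permutation′ n} (π-aut : IsAutomorphism G π) where

    ⟨$⟩ʳ-injective : ∀ {i j} → π ⟨$⟩ʳ i ≡ π ⟨$⟩ʳ j → i ≡ j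
    ⟨$⟩ʳ-injective e = trans (sym (inverseˡ π)) (trans (cong (π ⟨$⟩ˡ_) e) (inverseˡ π))

    isAut-∘ : ∀ {g} → IsAut g ⇔ IsAut ((π ⟨$⟩ʳ_) ∘ g)
    isAut-∘ = mk⇔
      (λ (inj , pres) → (λ i j → inj i j ∘ ⟨$⟩ʳ-injective) , (λ i j → trans (π-aut _ _) (pres i j)))
      (λ (inj , pres) → (λ i j → inj i j ∘ cong (π ⟨$⟩ʳ_)) , (λ i j → trans (sym (π-aut _ _)) (pres i j)))

    autWeight-map : ∀ f → autWeight (Vec.map (π ⟨$⟩ʳ_) f) ≡ autWeight f
    autWeight-map f = 𝟙-⇔ (mk⇔
      (Equivalence.from isAut-∘ ∘ isAut-cong (λ i → lookup-map i (π ⟨$⟩ʳ_) f))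
      (isAut-cong (λ i → sym (lookup-map i (π ⟨$⟩ʳ_) f)) ∘ Equivalence.to isAut-∘))
      (isAut? (Vec.lookup (Vec.map (π ⟨$⟩ʳ_) f))) (isAut? (Vec.lookup f))

  #aut : ℕ
  #aut = sumVec n autWeight

  #autTaking : Fin n → Fin n → ℕ
  #autTaking u v = sumVec n (λ f → autWeight f * 𝟙 (Vec.lookup f u ≟ v))

  0<#aut : 0 < #aut
  0<#aut = ≤-trans 1≤ (F≤sumVec n autWeight (Vec.tabulate id))
    where
    1≤ : 1 ≤ autWeight (Vec.tabulate id)
    1≤ = ≤-reflexive (sym (𝟙-true (isAut? _)
      (isAut-cong (λ i → sym (lookup∘tabulate id i)) ((λ _ _ e → e) , (λ _ _ → refl)))))

  coincidences : (Fin p → Fin n) → (Fin q → Fin n) → ℕ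
  coincidences a b = sum (λ i → sum (λ j → 𝟙 (a i ≟ b j)))

  module _ (transitive : VertexTransitive G) where

    -- Composing with an automorphism that takes `w` to `v` permutes the group and turns the maps
    -- `u ↦ w` into the maps `u ↦ v`.
    #autTaking-const : ∀ u v w → #autTaking u v ≡ #autTaking u w
    #autTaking-const u v w with transitive w v
    ... | π , π-aut , refl = trans
      (sumVec-permute n (λ f → autWeight f * 𝟙 (Vec.lookup f u ≟ (π ⟨$⟩ʳ w))) π)
      (sumVec-cong n (λ f → cong₂ _*_ (autWeight-map {π} π-aut f) (𝟙-⇔ (mk⇔
        (λ e → ⟨$⟩ʳ-injective {π} π-aut (trans (sym (lookup-map u (π ⟨$⟩ʳ_) f)) e))
        (λ e → trans (lookup-map u (π ⟨$⟩ʳ_) f) (cong (π ⟨$⟩ʳ_) e)))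
        (Vec.lookup (Vec.map (π ⟨$⟩ʳ_) f) u ≟ (π ⟨$⟩ʳ w)) (Vec.lookup f u ≟ w))))

    -- The image of `u` splits the group into `n` classes, all of the same size.
    #autTaking*n : ∀ u v → #autTaking u v * n ≡ #aut
    #autTaking*n u v = sym (begin
      #aut
        ≡⟨ sumVec-cong n (λ f → trans (sym (*-identityʳ _)) (trans (cong (autWeight f *_) (sym (sum-𝟙≡1 (Vec.lookup f u))))
             (*-distribˡ-sum (autWeight f) (λ w → 𝟙 (Vec.lookup f u ≟ w))))) ⟩
      sumVec n (λ f → sum (λ w → autWeight f * 𝟙 (Vec.lookup f u ≟ w)))
        ≡⟨ sumVec-sum n (λ f w → autWeight f * 𝟙 (Vec.lookup f u ≟ w)) ⟩
      sum (#autTaking u)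
        ≡⟨ sum-cong-≗ (λ w → #autTaking-const u w v) ⟩
      sum {n} (λ _ → #autTaking u v)
        ≡⟨ sum-const n _ ⟩
      n * #autTaking u v
        ≡⟨ *-comm n _ ⟩
      #autTaking u v * n ∎)
      where open ≡-Reasoning

    module _ (a : Fin p → Fin n) (b : Fin q → Fin n) where

      -- Double counting: each pair of indices is matched by a share 1/n of the automorphisms. The
      -- factor `n` keeps the average in the natural numbers.
      sum-coincidences : sumVec n (λ f → autWeight f * coincidences (Vec.lookup f ∘ a) b * n) ≡ p * (q * #aut)
      sum-coincidences = begin
        sumVec n (λ f → autWeight f * coincidences (Vec.lookup f ∘ a) b * n)
          ≡⟨ sumVec-*ʳ n (λ f → autWeight f * coincidences (Vec.lookup f ∘ a) b) n ⟨
        sumVec n (λ f → autWeight f * coincidences (Vec.lookup f ∘ a) b) * n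
          ≡⟨ cong (_* n) (sumVec-cong n (λ f → trans
               (*-distribˡ-sum (autWeight f) (λ i → sum (λ j → 𝟙 (Vec.lookup f (a i) ≟ b j))))
               (sum-cong-≗ (λ i → *-distribˡ-sum (autWeight f) (λ j → 𝟙 (Vec.lookup f (a i) ≟ b j)))))) ⟩
        sumVec n (λ f → sum (λ i → sum (λ j → autWeight f * 𝟙 (Vec.lookup f (a i) ≟ b j)))) * n
          ≡⟨ cong (_* n) (trans
               (sumVec-sum n (λ f i → sum (λ j → autWeight f * 𝟙 (Vec.lookup f (a i) ≟ b j))))
               (sum-cong-≗ (λ i → sumVec-sum n (λ f j → autWeight f * 𝟙 (Vec.lookup f (a i) ≟ b j))))) ⟩
        sum (λ i → sum (λ j → #autTaking (a i) (b j))) * n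
          ≡⟨ *-distribʳ-sum n (λ i → sum (λ j → #autTaking (a i) (b j))) ⟩
        sum (λ i → sum (λ j → #autTaking (a i) (b j)) * n)
          ≡⟨ sum-cong-≗ (λ i → trans (*-distribʳ-sum n (λ j → #autTaking (a i) (b j)))
               (sum-cong-≗ (λ j → #autTaking*n (a i) (b j)))) ⟩
        sum {p} (λ i → sum {q} (λ j → #aut))
          ≡⟨ trans (sum-cong-≗ {p} (λ _ → sum-const q #aut)) (sum-const p (q * #aut)) ⟩
        p * (q * #aut) ∎
        where open ≡-Reasoning

      sparse-translate : ∃[ g ] (IsAut g × coincidences (g ∘ a) b * n ≤ p * q)
      -- Comparing with `suc (p * q)` makes the total inequality strict, as the group is nonempty;
      -- for a single map it becomes `≤ p * q` again.
      sparse-translate with sumVec-<⇒∃< n _ (λ f → autWeight f * suc (p * q)) total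
        where
        total : sumVec n (λ f → autWeight f * coincidences (Vec.lookup f ∘ a) b * n) <
                sumVec n (λ f → autWeight f * suc (p * q))
        total = begin-strict
          sumVec n (λ f → autWeight f * coincidences (Vec.lookup f ∘ a) b * n) ≡⟨ sum-coincidences ⟩
          p * (q * #aut)                                                   ≡⟨ *-assoc p q #aut ⟨
          p * q * #aut                                                     <⟨ m<n+m _ 0<#aut ⟩
          #aut + p * q * #aut                                              ≡⟨ *-comm (suc (p * q)) #aut ⟩
          #aut * suc (p * q)                                               ≡⟨ sumVec-*ʳ n autWeight _ ⟩
          sumVec n (λ f → autWeight f * suc (p * q))                       ∎
          where open ≤-Reasoning
      ... | f , lt = Vec.lookup f , 𝟙-weighted (isAut? (Vec.lookup f)) lt

-- Trails and exchange of arcs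

-- The list of a trail omits the first vertex, so that lists of composable trails
-- concatenate and a cycle is a trail from a vertex to itself without repetition.
data Trail {V : Set} (R : V → V → Set) : V → List V → V → Set where
  []  : Trail R u [] u
  _∷_ : R u v → Trail R v xs w → Trail R u (v ∷ xs) w

_+++_ : Trail R u xs v → Trail R v ys w → Trail R u (xs ++ ys) w
[]      +++ t' = t'
(r ∷ t) +++ t' = r ∷ (t +++ t')

infixl 5 _∷ʳᵗ_
_∷ʳᵗ_ : Trail R u xs v → R v w → Trail R u (xs ∷ʳ w) w
t ∷ʳᵗ r = t +++ (r ∷ [])

trail-end : {P : V → Set} → Trail R u xs v → All P (u ∷ xs) → P v
trail-end []      (p ∷ _)  = p
trail-end (_ ∷ t) (_ ∷ ps) = trail-end t ps

-- Removes a loop when a walk comes back to `u`. The last component is polymorphic so that any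
-- property of the vertices survives.
suffix-from : Trail R x xs v → u ∈ x ∷ xs → Unique (x ∷ xs) →
  ∃[ ys ] (Trail R u ys v × Unique (u ∷ ys) × ∀ {P : V → Set} → All P (x ∷ xs) → All P (u ∷ ys))
suffix-from t       (here refl) uniq       = _ , t , uniq , id
suffix-from (_ ∷ t) (there u∈)  (_ ∷ uniq) with suffix-from t u∈ uniq
... | ys , t' , uniq' , all = ys , t' , uniq' , λ { (_ ∷ ps) → all ps }

-- The permutation is stated with the first vertices put back, since reversal changes which end the
-- list omits.
reverse-trail : (∀ {u v} → R u v → R v u) → Trail R u xs v →
  ∃[ ys ] (Trail R v ys u × u ∷ xs ↭ v ∷ ys)
reverse-trail R-sym [] = [] , [] , ↭-refl
reverse-trail {u = u} R-sym (r ∷ t) with reverse-trail R-sym t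
... | ys , t' , perm = ys ∷ʳ u , t' ∷ʳᵗ R-sym r ,
      ↭-trans (prep u perm) (∷↭∷ʳ u _)

lookup-injective : Unique xs → ∀ {i j : Fin (length xs)} → lookup xs i ≡ lookup xs j → i ≡ j
lookup-injective (_ ∷ _) {zero}  {zero}  _  = refl
lookup-injective u@(_ ∷ _) {zero}  {suc j} eq = ⊥-elim (Unique[x∷xs]⇒x∉xs u (subst (_∈ _) (sym eq) (∈-lookup j)))
lookup-injective u@(_ ∷ _) {suc i} {zero}  eq = ⊥-elim (Unique[x∷xs]⇒x∉xs u (subst (_∈ _) eq (∈-lookup i)))
lookup-injective (_ ∷ u) {suc i} {suc j} eq = cong suc (lookup-injective u eq)

trail-step : Trail R u xs v → ∀ (i j : Fin (length xs)) → suc (toℕ i) ≡ toℕ j → R (lookup xs i) (lookup xs j)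
trail-step (_ ∷ r ∷ _)     zero    (suc zero)    _  = r
trail-step (_ ∷ t@(_ ∷ _)) (suc i) (suc j) eq = trail-step t i j (suc-injective eq)

trail-last : Trail R u xs v → ∀ (i : Fin (length xs)) → suc (toℕ i) ≡ length xs → lookup xs i ≡ v
trail-last (_ ∷ [])        zero    _  = refl
trail-last (_ ∷ t@(_ ∷ _)) (suc i) eq = trail-last t i (suc-injective eq)

closed-trail⇒cycle : ∀ {n} {G : Graph n} {u xs} → Trail (Edge G) u xs u → Unique xs → 3 ≤ length xs →
  Cycle G (length xs)
closed-trail⇒cycle {G = G} {xs = xs@(_ ∷ _)} t@(r ∷ _) uniq 3≤ = record
  { len≥3 = 3≤
  ; vert  = lookup xs
  ; inj   = lookup-injective uniq
  ; step  = trail-step t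
  -- The last entry of the list is `u`, so the closing edge is the first edge of the trail.
  ; close = λ { i zero eq refl → subst (λ z → Edge G z _) (sym (trail-last t i eq)) r }
  }

-- A C–D path running inside U. That its inner vertices avoid C ∪ D is phrased by only-src and
-- only-tgt for all its vertices, so as to be invariant under reversal.
record Bridge {V : Set} (R : V → V → Set) (C D U : V → Set) : Set where
  field
    {src tgt} : V
    {inside}  : List V
    trail     : Trail R src inside tgt
    unique    : Unique (src ∷ inside)
    uses      : All U (src ∷ inside)
    only-src  : All (λ x → C x → x ≡ src) (src ∷ inside)
    only-tgt  : All (λ x → D x → x ≡ tgt) (src ∷ inside)
    src∈      : C src
    src∉      : ¬ D src
    tgt∈      : D tgt
    tgt∉      : ¬ C tgt

Unique-resp-↭ : xs ↭ ys → Unique xs → Unique ys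
Unique-resp-↭ _↭_.refl           uniq       = uniq
Unique-resp-↭ (prep x perm)     (≢xs ∷ uniq) = All-resp-↭ perm ≢xs ∷ Unique-resp-↭ perm uniq
Unique-resp-↭ (swap x y perm)   ((x≢y ∷ ≢xs) ∷ ≢ys ∷ uniq) =
  ((x≢y ∘ sym) ∷ All-resp-↭ perm ≢ys) ∷ All-resp-↭ perm ≢xs ∷ Unique-resp-↭ perm uniq
Unique-resp-↭ (_↭_.trans p q)   uniq       = Unique-resp-↭ q (Unique-resp-↭ p uniq)

flip-bridge : {C D U : V → Set} → (∀ {u v} → R u v → R v u) → Bridge R C D U → Bridge R D C U
flip-bridge R-sym B with reverse-trail R-sym (Bridge.trail B)
... | ys , t , perm = record
  { trail = t ; unique = Unique-resp-↭ perm unique ; uses = All-resp-↭ perm uses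
  ; only-src = All-resp-↭ perm only-tgt ; only-tgt = All-resp-↭ perm only-src
  ; src∈ = tgt∈ ; src∉ = tgt∉ ; tgt∈ = src∈ ; tgt∉ = src∉ }
  where open Bridge B

module _ {n : ℕ} {R : Fin n → Fin n → Set} {C D U : Fin n → Set} (C? : Decidable C) (D? : Decidable D) where

  private
    -- Invariant of a scan of the walk from its end: a simple trail off `C` from the present vertex
    -- to `D`, meeting `D` only at its end. A vertex of `D` off `C` restarts it, a vertex of `C` off
    -- `D` completes a bridge, a vertex already on it shortens it.
    Approach : Fin n → Set
    Approach a = ∃₂ λ v xs → Trail R a xs v × Unique (a ∷ xs) × D v ×
      All (λ x → U x × ¬ C x × (D x → x ≡ v)) (a ∷ xs)

    approach : ∀ {a b} → Walk R U a b → D b → (∃[ v ] (C v × D v × U v)) ⊎ Bridge R C D U ⊎ Approach a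
    approach (stay {a} p) b∈ with C? a
    ... | yes a∈ = inj₁ (a , a∈ , b∈ , p)
    ... | no a∉  = inj₂ (inj₂ (a , [] , [] , [] ∷ [] , b∈ , (p , a∉ , λ _ → refl) ∷ []))
    approach (go {a} p r w) b∈ with C? a | D? a
    ... | yes c | yes d = inj₁ (a , c , d , p)
    ... | no ¬c | yes d = inj₂ (inj₂ (a , [] , [] , [] ∷ [] , d , (p , ¬c , λ _ → refl) ∷ []))
    ... | yes c | no ¬d with approach w b∈
    ...   | inj₁ m        = inj₁ m
    ...   | inj₂ (inj₁ B) = inj₂ (inj₁ B)
    ...   | inj₂ (inj₂ (v , xs , t , uniq , v∈ , ps)) = inj₂ (inj₁ (record
            { trail    = r ∷ t
            ; unique   = All.map (λ { (_ , ¬c , _) refl → ¬c c }) ps ∷ uniq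
            ; uses     = p ∷ All.map proj₁ ps
            ; only-src = (λ _ → refl) ∷ All.map (λ { (_ , ¬c , _) c' → ⊥-elim (¬c c') }) ps
            ; only-tgt = (⊥-elim ∘ ¬d) ∷ All.map (proj₂ ∘ proj₂) ps
            ; src∈ = c ; src∉ = ¬d ; tgt∈ = v∈ ; tgt∉ = trail-end t (All.map (proj₁ ∘ proj₂) ps) }))
    approach (go {a} p r w) b∈ | no ¬c | no ¬d with approach w b∈
    ...   | inj₁ m        = inj₁ m
    ...   | inj₂ (inj₁ B) = inj₂ (inj₁ B)
    ...   | inj₂ (inj₂ (v , xs , t , uniq , v∈ , ps)) with member? _≟_ a (_ ∷ xs)
    ...     | no a∉ = inj₂ (inj₂ (v , _ , r ∷ t , ¬Any⇒All¬ _ a∉ ∷ uniq , v∈ , (p , ¬c , ⊥-elim ∘ ¬d) ∷ ps))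
    ...     | yes a∈ with suffix-from t a∈ uniq
    ...       | ys , t' , uniq' , all = inj₂ (inj₂ (v , ys , t' , uniq' , v∈ , all ps))

  walk⇒bridge : ∀ {a b} → C a → D b → Walk R U a b → (∃[ v ] (C v × D v × U v)) ⊎ Bridge R C D U
  walk⇒bridge a∈ b∈ w with approach w b∈
  ... | inj₁ m        = inj₁ m
  ... | inj₂ (inj₁ B) = inj₂ B
  ... | inj₂ (inj₂ (_ , _ , _ , _ , _ , (_ , a∉ , _) ∷ _)) = ⊥-elim (a∉ a∈)

-- The two arcs between u and u' of a cycle of length L on the vertex set C.
record Arc {V : Set} (R : V → V → Set) (C D : V → Set) (L : ℕ) (u u' : V) : Set where
  field
    {inner outer}   : List V
    inner-trail     : Trail R u inner u'
    outer-trail     : Trail R u' outer u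
    inner-unique    : Unique (u ∷ inner)
    outer-unique    : Unique (u' ∷ outer)
    inner-avoids          : All (λ x → ¬ D x) (u ∷ inner)
    inner-on        : All C (u ∷ inner)
    outer-on          : All C (u' ∷ outer)
    lengths         : length inner + length outer ≡ L

flip-arc : {C D : V → Set} {L : ℕ} → (∀ {u v} → R u v → R v u) → Arc R C D L u v → Arc R C D L v u
flip-arc {L = L} R-sym A with reverse-trail R-sym (Arc.inner-trail A) | reverse-trail R-sym (Arc.outer-trail A)
... | ys , t , perm | ys' , t' , perm' = record
  { inner-trail = t ; outer-trail = t'
  ; inner-unique = Unique-resp-↭ perm inner-unique
  ; outer-unique = Unique-resp-↭ perm' outer-unique
  ; inner-avoids = All-resp-↭ perm inner-avoids
  ; inner-on = All-resp-↭ perm inner-on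
  ; outer-on = All-resp-↭ perm' outer-on
  ; lengths = trans (sym (cong₂ _+_ (suc-injective (↭-length perm)) (suc-injective (↭-length perm')))) lengths }
  where open Arc A

Longer : ∀ {n} → Graph n → ℕ → Set
Longer G L = ∃[ L' ] (L < L' × Cycle G L')

edge-sym : ∀ {n} (G : Graph n) {u v} → Edge G u v → Edge G v u
edge-sym G e = trans (symm G _ _) e

module _ {n : ℕ} (G : Graph n) {L : ℕ} (3≤L : 3 ≤ L) where

  open Bridge
  open Arc

  -- Replace the inner arc of the cycle on C by B, the inner arc of the cycle on D, and B'.
  detour : ∀ {C D U U'} (B : Bridge (Edge G) C D U) (B' : Bridge (Edge G) C D U') →
    (∀ {x} → U x → U' x → ⊥) →
    (α : Arc (Edge G) C D L (src B) (src B')) (β : Arc (Edge G) D C L (tgt B) (tgt B')) →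
    length (inner α) ≤ length (inner β) → Longer G L
  detour {D = D} B B' U∩U' α β ≤β with reverse-trail (edge-sym G) (trail B')
  ... | ys , t , perm = length cycle , L<cycle ,
        closed-trail⇒cycle {G = G} (outer-trail α +++ (trail B +++ (inner-trail β +++ t))) cycle-unique
          (≤-trans 3≤L (≤-trans (n≤1+n L) L<cycle))
    where
    cycle = outer α ++ inside B ++ inner β ++ ys

    nonempty : ∀ {x xs y} → x ≢ y → Trail (Edge G) x xs y → 1 ≤ length xs
    nonempty x≢y []      = ⊥-elim (x≢y refl)
    nonempty x≢y (_ ∷ _) = s≤s z≤n

    L<cycle : L < length cycle
    L<cycle = begin-strict
      L                                                      ≡⟨ lengths α ⟨
      length (inner α) + length (outer α)                    ≤⟨ +-mono-≤ ≤β ≤-refl ⟩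
      length (inner β) + length (outer α)                    ≡⟨ +-comm (length (inner β)) _ ⟩
      length (outer α) + length (inner β)
        -- The strict gain is `B`, which has an edge because its ends are distinct.
        <⟨ +-monoʳ-< (length (outer α)) (+-mono-≤ (nonempty src≢tgt (trail B)) (m≤m+n _ (length ys))) ⟩
      length (outer α) + (length (inside B) + (length (inner β) + length ys))
        ≡⟨ cong (λ l → length (outer α) + (length (inside B) + l)) (length-++ (inner β)) ⟨
      length (outer α) + (length (inside B) + length (inner β ++ ys))
        ≡⟨ cong (length (outer α) +_) (length-++ (inside B)) ⟨
      length (outer α) + length (inside B ++ inner β ++ ys)  ≡⟨ length-++ (outer α) ⟨
      length cycle                                           ∎
      where
      open ≤-Reasoning
      src≢tgt : src B ≢ tgt B
      src≢tgt eq = src∉ B (subst D (sym eq) (tgt∈ B))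

    ys-unique   = Unique-resp-↭ perm (unique B')
    ys-uses     = All-resp-↭ perm (uses B')
    ys-only-src = All-resp-↭ perm (only-src B')
    ys-only-tgt = All-resp-↭ perm (only-tgt B')

    cycle-unique : Unique cycle
    -- Each piece omits its first vertex, so junctions are listed once. Otherwise the pieces are
    -- disjoint: bridges meet the cycles only at their ends, `inner β` avoids the first cycle, and
    -- `U∩U'` keeps the bridges apart.
    cycle-unique =
      ++⁺ (tail-unique (outer-unique α))
        (++⁺ (tail-unique (unique B))
          (++⁺ (tail-unique (inner-unique β)) (tail-unique ys-unique)
            (λ { (x∈β , x∈ys) → Unique[x∷xs]⇒x∉xs ys-unique (subst (_∈ ys)
              (All.lookup ys-only-tgt (there x∈ys) (All.lookup (inner-on β) (there x∈β))) x∈ys) }))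
          (λ { (x∈B , x∈) → [ (λ x∈β → Unique[x∷xs]⇒x∉xs (inner-unique β) (subst (_∈ inner β)
                  (All.lookup (only-tgt B) (there x∈B) (All.lookup (inner-on β) (there x∈β))) x∈β))
              , (λ x∈ys → U∩U' (All.lookup (uses B) (there x∈B)) (All.lookup ys-uses (there x∈ys))) ]′
              (∈-++⁻ (inner β) x∈) }))
        (λ { (x∈α , x∈) → [ (λ x∈B → Unique[x∷xs]⇒x∉xs (unique B) (subst (_∈ inside B)
                (All.lookup (only-src B) (there x∈B) (All.lookup (outer-on α) (there x∈α))) x∈B))
            , (λ x∈' → [ (λ x∈β → All.lookup (inner-avoids β) (there x∈β) (All.lookup (outer-on α) (there x∈α)))
                , (λ x∈ys → Unique[x∷xs]⇒x∉xs (outer-unique α) (subst (_∈ outer α)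
                    (All.lookup ys-only-src (there x∈ys) (All.lookup (outer-on α) (there x∈α))) x∈α)) ]′
                (∈-++⁻ (inner β) x∈')) ]′
            (∈-++⁻ (inside B) x∈) })
      where
      tail-unique : ∀ {x : Fin n} {xs} → Unique (x ∷ xs) → Unique xs
      tail-unique (_ ∷ uniq) = uniq

  -- The longer inner arc has to be the one inserted, so the roles of the two cycles are swapped if
  -- necessary.
  exchange : ∀ {C D U U'} (B : Bridge (Edge G) C D U) (B' : Bridge (Edge G) C D U') →
    (∀ {x} → U x → U' x → ⊥) →
    Arc (Edge G) C D L (src B) (src B') → Arc (Edge G) D C L (tgt B) (tgt B') → Longer G L
  exchange B B' U∩U' α β with ≤-total (length (inner α)) (length (inner β))
  ... | inj₁ ≤β = detour B B' U∩U' α β ≤β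
  ... | inj₂ ≤α = detour (flip-bridge (edge-sym G) B) (flip-bridge (edge-sym G) B') U∩U' β α ≤α

-- Cycles as periodic sequences

module Round {n : ℕ} {G : Graph n} {L : ℕ} (C : Cycle G L) where

  open Cycle C

  On : Fin n → Set
  On = Image vert

  private instance
    L≢0 : NonZero L
    L≢0 = >-nonZero (≤-trans (s≤s z≤n) len≥3)

  at : ℕ → Fin n
  at k = vert (fromℕ< (m%n<n k L))

  at-on : ∀ k → On (at k)
  at-on k = _ , refl

  at-cong : ∀ {k k'} → k % L ≡ k' % L → at k ≡ at k'
  at-cong eq = cong vert (toℕ-injective (trans (toℕ-fromℕ< _) (trans eq (sym (toℕ-fromℕ< _)))))

  at-toℕ : ∀ i → at (toℕ i) ≡ vert i
  at-toℕ i = cong vert (toℕ-injective (trans (toℕ-fromℕ< _) (m<n⇒m%n≡m (toℕ<n i))))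

  at-period : ∀ k → at (k + L) ≡ at k
  at-period k = at-cong ([m+n]%n≡m%n k L)

  suc-% : ∀ k → suc k % L ≡ suc (k % L) % L
  suc-% k = trans (cong (λ j → suc j % L) (m≡m%n+[m/n]*n k L)) ([m+kn]%n≡m%n (suc (k % L)) (k / L) L)

  at-edge : ∀ k → Edge G (at k) (at (suc k))
  at-edge k with suc (k % L) <? L
  ... | yes lt = step _ _ (trans (cong suc (toℕ-fromℕ< _))
      (sym (trans (toℕ-fromℕ< _) (trans (suc-% k) (m<n⇒m%n≡m lt)))))
  ... | no ≮ = close _ _ (trans (cong suc (toℕ-fromℕ< _)) last)
      (trans (toℕ-fromℕ< _) (trans (suc-% k) (trans (cong (_% L) last) (n%n≡0 L))))
    where
    last : suc (k % L) ≡ L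
    last = ≤-antisym (m%n<n k L) (≮⇒≥ ≮)

  -- Equal vertices have equal residues; distinct indices then differ in their quotients and lie at
  -- least `L` apart.
  at-window : ∀ {i k} → i < k → k < i + L → at i ≢ at k
  at-window {i} {k} i<k k<i+L eq = <⇒≱ k<i+L (begin
    i + L                          ≡⟨ cong (_+ L) (m≡m%n+[m/n]*n i L) ⟩
    i % L + i / L * L + L          ≡⟨ +-assoc (i % L) _ L ⟩
    i % L + (i / L * L + L)        ≡⟨ cong₂ _+_ i%≡k% (+-comm (i / L * L) L) ⟩
    k % L + suc (i / L) * L        ≤⟨ +-monoʳ-≤ (k % L) (*-monoˡ-≤ L quotients) ⟩
    k % L + k / L * L              ≡⟨ m≡m%n+[m/n]*n k L ⟨
    k                              ∎)
    where
    open ≤-Reasoning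
    i%≡k% : i % L ≡ k % L
    i%≡k% = fromℕ<-injective _ _ (m%n<n i L) (m%n<n k L) (inj eq)
    quotients : i / L < k / L
    quotients = ≤∧≢⇒< (/-monoˡ-≤ L (<⇒≤ i<k)) λ e → <⇒≢ i<k (trans (m≡m%n+[m/n]*n i L)
      (trans (cong₂ (λ r q → r + q * L) i%≡k% e) (sym (m≡m%n+[m/n]*n k L))))

  segment : ℕ → ℕ → List (Fin n)
  segment i zero    = []
  segment i (suc d) = at i ∷ segment (suc i) d

  segment-length : ∀ i d → length (segment i d) ≡ d
  segment-length i zero    = refl
  segment-length i (suc d) = cong suc (segment-length (suc i) d)

  segment-all : ∀ {P : Fin n → Set} i d → (∀ k → i ≤ k → k < i + d → P (at k)) → All P (segment i d)
  segment-all i zero    h = []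
  segment-all i (suc d) h = h i ≤-refl (m<m+n i (s≤s z≤n)) ∷
    segment-all (suc i) d (λ k i<k k< → h k (<⇒≤ i<k) (subst (k <_) (sym (+-suc i d)) k<))

  segment-unique : ∀ i d → d ≤ L → Unique (segment i d)
  segment-unique i zero    _  = []
  segment-unique i (suc d) d<L =
    segment-all (suc i) d (λ k i<k k< → at-window i<k (<-≤-trans k< (subst (_≤ i + L) (+-suc i d) (+-monoʳ-≤ i d<L))))
    ∷ segment-unique (suc i) d (<⇒≤ d<L)

  segment-trail : ∀ i d → Trail (Edge G) (at i) (segment (suc i) d) (at (i + d))
  segment-trail i zero    = subst (λ k → Trail (Edge G) (at i) [] (at k)) (sym (+-identityʳ i)) []
  segment-trail i (suc d) = at-edge i ∷
    subst (λ k → Trail (Edge G) (at (suc i)) (segment (suc (suc i)) d) (at k)) (sym (+-suc i d)) (segment-trail (suc i) d)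

  arc : ∀ {D : Fin n → Set} {i i'} → i < i' → i' < L → (∀ k → i ≤ k → k ≤ i' → ¬ D (at k)) →
    Arc (Edge G) On D L (at i) (at i')
  arc {i = i} {i'} i<i' i'<L avoid = record
    { inner-trail  = subst (λ k → Trail (Edge G) (at i) (segment (suc i) δ) (at k)) i+δ (segment-trail i δ)
    -- The outer arc runs on past the closing edge to the copy of `at i` one period later.
    ; outer-trail  = subst (Trail (Edge G) (at i') (segment (suc i') (L ∸ δ))) around (segment-trail i' (L ∸ δ))
    ; inner-unique = segment-unique i (suc δ) δ<L
    ; outer-unique = segment-unique i' (suc (L ∸ δ)) (∸-monoʳ-< {o = 0} (m<n⇒0<n∸m i<i') (<⇒≤ δ<L))
    ; inner-avoids = segment-all i (suc δ) (λ k i≤k k< → avoid k i≤k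
                         (≤-pred (subst (k <_) (trans (+-suc i δ) (cong suc i+δ)) k<)))
    ; inner-on     = segment-all i (suc δ) (λ k _ _ → at-on k)
    ; outer-on     = segment-all i' (suc (L ∸ δ)) (λ k _ _ → at-on k)
    ; lengths      = trans (cong₂ _+_ (segment-length (suc i) δ) (segment-length (suc i') (L ∸ δ)))
                         (m+[n∸m]≡n (<⇒≤ δ<L))
    }
    where
    δ = i' ∸ i
    i+δ : i + δ ≡ i'
    i+δ = m+[n∸m]≡n (<⇒≤ i<i')
    δ<L : δ < L
    δ<L = ≤-<-trans (m∸n≤m i' i) i'<L
    around : at (i' + (L ∸ δ)) ≡ at i
    around = trans (cong at (trans (cong (_+ (L ∸ δ)) (sym i+δ))
      (trans (+-assoc i δ (L ∸ δ)) (cong (i +_) (m+[n∸m]≡n (<⇒≤ δ<L)))))) (at-period i)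

  module Rank {D : Fin n → Set} (D? : Decidable D) where

    -- Numbers the segments left by `D` when the cycle is cut open at index 0. This cut is why `m`
    -- vertices of `D` can give `suc m` ranks.
    rank : ℕ → ℕ
    rank k = sum {k} (λ j → 𝟙 (D? (at (toℕ j))))

    rank-mono : ∀ {j k} → j ≤ k → rank j ≤ rank k
    rank-mono = prefix-mono (λ j → 𝟙 (D? (at j)))
      where
      prefix-mono : ∀ (f : ℕ → ℕ) {j k} → j ≤ k → sum {j} (f ∘ toℕ) ≤ sum {k} (f ∘ toℕ)
      prefix-mono f z≤n       = z≤n
      prefix-mono f (s≤s j≤k) = +-monoʳ-≤ (f 0) (prefix-mono (f ∘ suc) j≤k)

    rank-strict : ∀ {j k} → D (at j) → j < k → rank j < rank k
    rank-strict {j} d = prefix-strict (λ j → 𝟙 (D? (at j))) (≤-reflexive (sym (𝟙-true (D? (at j)) d)))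
      where
      prefix-strict : ∀ (f : ℕ → ℕ) {j k} → 1 ≤ f j → j < k → sum {j} (f ∘ toℕ) < sum {k} (f ∘ toℕ)
      prefix-strict f {zero}  {suc k} h j<k       = ≤-trans h (m≤m+n _ _)
      prefix-strict f {suc j} {suc k} h (s≤s j<k) = +-monoʳ-< (f 0) (prefix-strict (f ∘ suc) h j<k)

    -- A hit before `i'` would raise the rank. The index `i'` itself is not counted in its own rank,
    -- hence the assumption on it.
    no-hit-between : ∀ {i i'} → rank i ≡ rank i' → ¬ D (at i') → ∀ k → i ≤ k → k ≤ i' → ¬ D (at k)
    no-hit-between eq i'∉ k i≤k k≤i' d with m≤n⇒m<n∨m≡n k≤i'
    ... | inj₁ k<i' = <⇒≢ (≤-<-trans (rank-mono i≤k) (rank-strict d k<i')) eq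
    ... | inj₂ refl = i'∉ d

    arc-within-rank : ∀ {i i'} → i < L → i' < L → at i ≢ at i' → ¬ D (at i) → ¬ D (at i') →
      rank i ≡ rank i' → Arc (Edge G) On D L (at i) (at i')
    arc-within-rank {i} {i'} i<L i'<L i≢i' i∉ i'∉ eq with <-cmp i i'
    ... | tri< i<i' _ _ = arc i<i' i'<L (no-hit-between eq i'∉)
    ... | tri≈ _ refl _ = ⊥-elim (i≢i' refl)
    ... | tri> _ _ i'<i = flip-arc (edge-sym G) (arc i'<i i<L (no-hit-between (sym eq) i∉))

-- Two cycles: an exchange or a small separator

encode : ∀ {m p q} → Fin m ⊎ (Fin p × Fin q) → Fin (m + p * q)
encode {m} {p} {q} = join m (p * q) ∘ Sum.map₂ (λ (r , s) → combine r s)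

encode-injective : ∀ {m p q} (x y : Fin m ⊎ (Fin p × Fin q)) → encode x ≡ encode y → x ≡ y
encode-injective {m} x y eq =
  map₂-combine-injective x y (trans (sym (splitAt-join m _ _)) (trans (cong (splitAt m) eq) (splitAt-join m _ _)))
  where
  map₂-combine-injective : ∀ {m p q} (x y : Fin m ⊎ (Fin p × Fin q)) →
    Sum.map₂ (λ (r , s) → combine r s) x ≡ Sum.map₂ (λ (r , s) → combine r s) y → x ≡ y
  map₂-combine-injective (inj₁ _) (inj₁ _) refl = refl
  map₂-combine-injective (inj₂ (r , s)) (inj₂ (r' , s')) e with combine-injective r s r' s' (inj₂-injective e)
  ... | refl , refl = refl

module _ {n : ℕ} (G : Graph n) where

  coincidences-comm : ∀ {p q} (a : Fin p → Fin n) (b : Fin q → Fin n) → coincidences G a b ≡ coincidences G b a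
  coincidences-comm a b = trans (∑-comm (λ i j → 𝟙 (a i ≟ b j)))
    (sum-cong-≗ (λ j → sum-cong-≗ (λ i → 𝟙-⇔ (mk⇔ sym sym) (a i ≟ b j) (b j ≟ a i))))

  hits≤coincidences : ∀ {p q} (a : Fin p → Fin n) (b : Fin q → Fin n) →
    sum (λ i → 𝟙 (image? b (a i))) ≤ coincidences G a b
  hits≤coincidences a b = sum-mono pointwise
    where
    pointwise : ∀ i → 𝟙 (image? b (a i)) ≤ sum (λ j → 𝟙 (a i ≟ b j))
    pointwise i with image? b (a i)
    ... | no _          = z≤n
    ... | yes (j , eq)  = ≤-trans (≤-reflexive (sym (𝟙-true (a i ≟ b j) eq))) (f≤sum (λ j → 𝟙 (a i ≟ b j)) j)

  -- Each edge contributes both of its arcs, so Menger's theorem for directed arcs becomes the one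
  -- for the graph.
  arcs : List (Fin n × Fin n)
  arcs = filter (λ (u , v) → adj G u v ≟ᵇ true) (cartesianProduct (allFin n) (allFin n))

  edge⇒arc : ∀ {u v} → Edge G u v → Arcs arcs u v
  edge⇒arc e = ∈-filter⁺ _ (∈-cartesianProduct⁺ (∈-allFin _) (∈-allFin _)) e

  arc⇒edge : ∀ {u v} → Arcs arcs u v → Edge G u v
  arc⇒edge uv∈ = proj₂ (∈-filter⁻ (λ (u , v) → adj G u v ≟ᵇ true) {xs = cartesianProduct (allFin n) (allFin n)} uv∈)

  rank≤coincidences : ∀ {L} (C D : Cycle G L) →
    Round.Rank.rank C (image? (Cycle.vert D)) L ≤ coincidences G (Cycle.vert C) (Cycle.vert D)
  rank≤coincidences C D =
    ≤-trans (≤-reflexive (sum-cong-≗ (λ i → cong (λ v → 𝟙 (image? (Cycle.vert D) v)) (Round.at-toℕ C i))))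
      (hits≤coincidences (Cycle.vert C) (Cycle.vert D))

  menger-graph : {A B : Fin n → Set} → Decidable A → Decidable B → Fin n → ∀ k →
    Linkage (Edge G) A B (suc k) ⊎ (Σ (Fin k → Fin n) (Separates (Edge G) A B))
  menger-graph A? B? v₀ k with menger arcs A? B? v₀ k
  ... | inj₂ (S , S-sep) = inj₂ (S , λ a∈ b∈ w → S-sep a∈ b∈ (map-walk edge⇒arc id w))
  ... | inj₁ K = inj₁ (record
    { Uses = Uses K ; disjoint = disjoint K ; src = src K ; tgt = tgt K
    ; src∈ = src∈ K ; tgt∈ = tgt∈ K ; walk = λ i → map-walk arc⇒edge id (walk K i) })
    where open Linkage

  module _ {L : ℕ} (C D : Cycle G L) where

    private
      module C = Round C
      module D = Round D
      module CR = C.Rank (image? (Cycle.vert D))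
      module DR = D.Rank (image? (Cycle.vert C))

      m : ℕ
      m = coincidences G (Cycle.vert C) (Cycle.vert D)

      C-rank≤ : ∀ {k} → k ≤ L → CR.rank k ≤ m
      C-rank≤ k≤L = ≤-trans (CR.rank-mono k≤L) (rank≤coincidences C D)

      D-rank≤ : ∀ {k} → k ≤ L → DR.rank k ≤ m
      D-rank≤ k≤L = ≤-trans (DR.rank-mono k≤L) (≤-trans (rank≤coincidences D C)
        (≤-reflexive (coincidences-comm (Cycle.vert D) (Cycle.vert C))))

      Connection : (Fin n → Set) → Set
      Connection U = (∃[ v ] (C.On v × D.On v × U v)) ⊎ Bridge (Edge G) C.On D.On U

      -- A common vertex is determined by its rank on C, and two bridges with the same ranks
      -- at both ends can be exchanged.
      label : ∀ {U} → Connection U → Fin m ⊎ (Fin (suc m) × Fin (suc m))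
      label (inj₁ (v , (p , v≡) , d , _)) = inj₁ (fromℕ< {CR.rank (toℕ p)} (<-≤-trans
        (CR.rank-strict (subst D.On (trans v≡ (sym (C.at-toℕ p))) d) (toℕ<n p)) (C-rank≤ ≤-refl)))
      label (inj₂ B) = inj₂ (fromℕ< {CR.rank (toℕ (proj₁ src∈))} (s≤s (C-rank≤ (<⇒≤ (toℕ<n (proj₁ src∈))))) ,
                             fromℕ< {DR.rank (toℕ (proj₁ tgt∈))} (s≤s (D-rank≤ (<⇒≤ (toℕ<n (proj₁ tgt∈))))))
        where open Bridge B

      same-label⇒longer : ∀ {U U'} (X : Connection U) (Y : Connection U') → (∀ {x} → U x → U' x → ⊥) →
        label X ≡ label Y → Longer G L
      -- Both vertices lie on `D`, so the rank grows past the earlier one. Equal ranks thus mean one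
      -- vertex, which cannot lie on two disjoint walks.
      same-label⇒longer (inj₁ (v , (p , refl) , d , u)) (inj₁ (v' , (p' , refl) , d' , u')) U∩U' eq
        with <-cmp (toℕ p) (toℕ p')
      ... | tri< p<p' _ _ = ⊥-elim (<⇒≢ (CR.rank-strict (subst D.On (sym (C.at-toℕ p)) d) p<p')
                              (fromℕ<-injective _ _ _ _ (inj₁-injective eq)))
      ... | tri> _ _ p'<p = ⊥-elim (<⇒≢ (CR.rank-strict (subst D.On (sym (C.at-toℕ p')) d') p'<p)
                              (sym (fromℕ<-injective _ _ _ _ (inj₁-injective eq))))
      ... | tri≈ _ p≡p' _ with refl ← toℕ-injective p≡p' = ⊥-elim (U∩U' u u')
      same-label⇒longer (inj₂ B) (inj₂ B') U∩U' eq = exchange G (Cycle.len≥3 C) B B' U∩U'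
        (subst₂ (Arc (Edge G) C.On D.On L) (src≡ B) (src≡ B')
          (CR.arc-within-rank (toℕ<n _) (toℕ<n _)
            (λ e → U∩U' (All.head (uses B)) (subst _ (trans (sym (src≡ B')) (trans (sym e) (src≡ B))) (All.head (uses B'))))
            (src∉ B ∘ subst D.On (src≡ B)) (src∉ B' ∘ subst D.On (src≡ B'))
            (fromℕ<-injective _ _ _ _ (cong proj₁ (inj₂-injective eq)))))
        (subst₂ (Arc (Edge G) D.On C.On L) (tgt≡ B) (tgt≡ B')
          (DR.arc-within-rank (toℕ<n _) (toℕ<n _)
            (λ e → U∩U' (tgt-uses B) (subst _ (trans (sym (tgt≡ B')) (trans (sym e) (tgt≡ B))) (tgt-uses B')))
            (tgt∉ B ∘ subst C.On (tgt≡ B)) (tgt∉ B' ∘ subst C.On (tgt≡ B'))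
            (fromℕ<-injective _ _ _ _ (cong proj₂ (inj₂-injective eq)))))
        where
        open Bridge
        src≡ : ∀ {U} (B : Bridge (Edge G) C.On D.On U) → C.at (toℕ (proj₁ (src∈ B))) ≡ src B
        src≡ B = trans (C.at-toℕ _) (sym (proj₂ (src∈ B)))
        tgt≡ : ∀ {U} (B : Bridge (Edge G) C.On D.On U) → D.at (toℕ (proj₁ (tgt∈ B))) ≡ tgt B
        tgt≡ B = trans (D.at-toℕ _) (sym (proj₂ (tgt∈ B)))
        tgt-uses : ∀ {U} (B : Bridge (Edge G) C.On D.On U) → U (tgt B)
        tgt-uses B = trail-end (trail B) (uses B)

    -- There are `m` labels for common vertices and `suc m * suc m` for bridges; Menger supplies one
    -- walk more than that, so two walks share a label.
    longer-or-separated : Longer G L ⊎ (Σ (Fin (m + suc m * suc m) → Fin n) (Separates (Edge G) C.On D.On))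
    longer-or-separated with menger-graph (image? (Cycle.vert C)) (image? (Cycle.vert D)) (C.at 0) (m + suc m * suc m)
    ... | inj₂ separated = inj₂ separated
    ... | inj₁ K = inj₁ (same-label⇒longer (connection i) (connection j)
                     (λ u u' → <⇒≢ᶠ i<j (disjoint u u')) (encode-injective _ _ same))
      where
      open Linkage K
      connection : ∀ i → Connection (Uses i)
      connection i = walk⇒bridge (image? (Cycle.vert C)) (image? (Cycle.vert D)) (src∈ i) (tgt∈ i) (walk i)
      clash = pigeonhole ≤-refl (encode ∘ label ∘ connection)
      i = proj₁ clash
      j = proj₁ (proj₂ clash)
      i<j = proj₁ (proj₂ (proj₂ clash))
      same = proj₂ (proj₂ (proj₂ clash))

-- Arithmetic

-- Substitute m ≤ l² / n in n ≤ (m² + 3 m + 1) l and clear denominators.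
cubic-bound : ∀ n l m → m * n ≤ l * l → n ≤ (m + suc m * suc m) * l →
  n ^ 3 ≤ l ^ 5 + (3 * (l ^ 3 * n) + l * n ^ 2)
cubic-bound n l m mn≤ll n≤ = begin
  n ^ 3                                              ≡⟨⟩
  n * n ^ 2                                          ≤⟨ *-monoˡ-≤ (n ^ 2) n≤ ⟩
  (m + suc m * suc m) * l * n ^ 2                    ≡⟨ expand n l m ⟩
  l * ((m * n) * (m * n)) + (3 * (l * (m * n) * n) + l * n ^ 2)
    ≤⟨ +-mono-≤ (*-monoʳ-≤ l (*-mono-≤ mn≤ll mn≤ll))
         (+-monoˡ-≤ (l * n ^ 2) (*-monoʳ-≤ 3 (*-monoˡ-≤ n (*-monoʳ-≤ l mn≤ll)))) ⟩
  l * ((l * l) * (l * l)) + (3 * (l * (l * l) * n) + l * n ^ 2) ≡⟨ collect n l ⟩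
  l ^ 5 + (3 * (l ^ 3 * n) + l * n ^ 2)              ∎
  where
  open ≤-Reasoning
  open +-*-Solver
  expand : ∀ n l m → (m + suc m * suc m) * l * n ^ 2 ≡ l * ((m * n) * (m * n)) + (3 * (l * (m * n) * n) + l * n ^ 2)
  expand = solve 3 (λ n l m → (m :+ (con 1 :+ m) :* (con 1 :+ m)) :* l :* n :^ 2
    := l :* ((m :* n) :* (m :* n)) :+ (con 3 :* (l :* (m :* n) :* n) :+ l :* n :^ 2)) refl
  collect : ∀ n l → l * ((l * l) * (l * l)) + (3 * (l * (l * l) * n) + l * n ^ 2) ≡ l ^ 5 + (3 * (l ^ 3 * n) + l * n ^ 2)
  collect = solve 2 (λ n l → l :* ((l :* l) :* (l :* l)) :+ (con 3 :* (l :* (l :* l) :* n) :+ l :* n :^ 2)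
    := l :^ 5 :+ (con 3 :* (l :^ 3 :* n) :+ l :* n :^ 2)) refl

^-distribʳ-* : ∀ k a b → (a * b) ^ k ≡ a ^ k * b ^ k
^-distribʳ-* zero    a b = refl
^-distribʳ-* (suc k) a b = trans (cong (a * b *_) (^-distribʳ-* k a b)) ([m*n]*[o*p]≡[m*o]*[n*p] a b _ _)

^-cancelˡ-≤ : ∀ k {a b} → a ^ suc k ≤ b ^ suc k → a ≤ b
^-cancelˡ-≤ k {a} {b} le with a ≤? b
... | yes a≤b = a≤b
... | no a≰b  = contradiction le (<⇒≱ (^-monoˡ-< (suc k) (≰⇒> a≰b)))

-- If l⁵ ≤ n³ and K⁵ ≤ n, then the error terms 3 l³ n and l n² above are at most 3 n³ / K and
-- n³ / K; the loss 4 / K is 1 / (j + 1).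
length-bound : ∀ j n l m → (4 * suc j) ^ 5 ≤ n → m * n ≤ l * l → n ≤ (m + suc m * suc m) * l →
  j ^ 5 * n ^ 3 ≤ suc j ^ 5 * l ^ 5
length-bound j n l m N≤n mn≤ll n≤ with ≤-total (n ^ 3) (l ^ 5)
... | inj₁ n³≤l⁵ = *-mono-≤ (^-monoˡ-≤ 5 (n≤1+n j)) n³≤l⁵
... | inj₂ l⁵≤n³ = begin
  j ^ 5 * n ^ 3                 ≡⟨ split j (n ^ 3) ⟩
  j ^ 4 * (j * n ^ 3)           ≤⟨ *-mono-≤ (^-monoˡ-≤ 4 (n≤1+n j)) linear ⟩
  suc j ^ 4 * (suc j * l ^ 5)   ≡⟨ split (suc j) (l ^ 5) ⟨
  suc j ^ 5 * l ^ 5             ∎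
  where
  open ≤-Reasoning
  K = 4 * suc j

  split : ∀ a b → a ^ 5 * b ≡ a ^ 4 * (a * b)
  split = solve 2 (λ a b → a :^ 5 :* b := a :^ 4 :* (a :* b)) refl
    where open +-*-Solver

  Kl³≤n² : K * l ^ 3 ≤ n ^ 2
  -- Fifth powers are compared, since the assumptions bound K⁵ by n and l⁵ by n³.
  Kl³≤n² = ^-cancelˡ-≤ 4 (begin
    (K * l ^ 3) ^ 5       ≡⟨ ^-distribʳ-* 5 K (l ^ 3) ⟩
    K ^ 5 * (l ^ 3) ^ 5   ≡⟨ cong (K ^ 5 *_) (trans (^-*-assoc l 3 5) (sym (^-*-assoc l 5 3))) ⟩
    K ^ 5 * (l ^ 5) ^ 3   ≤⟨ *-mono-≤ N≤n (^-monoˡ-≤ 3 l⁵≤n³) ⟩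
    n * (n ^ 3) ^ 3       ≡⟨ cong (n *_) (^-*-assoc n 3 3) ⟩
    n ^ 10                ≡⟨ ^-*-assoc n 2 5 ⟨
    (n ^ 2) ^ 5           ∎)

  Kl≤n : K * l ≤ n
  Kl≤n = ^-cancelˡ-≤ 4 (begin
    (K * l) ^ 5    ≡⟨ ^-distribʳ-* 5 K l ⟩
    K ^ 5 * l ^ 5  ≤⟨ *-mono-≤ N≤n l⁵≤n³ ⟩
    n ^ 4          ≤⟨ m≤m*n (n ^ 4) n ⦃ >-nonZero 0<n ⦄ ⟩
    n ^ 4 * n      ≡⟨ *-comm (n ^ 4) n ⟩
    n ^ 5          ∎)
    where
    0<n : 0 < n
    0<n = (≤-trans (m^n>0 K 5) N≤n)

  linear : j * n ^ 3 ≤ suc j * l ^ 5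
  -- Adding n³ and multiplying by 4 makes the left side K n³, to which the cubic bound applies; the
  -- error terms then sum to 4 n³.
  linear = +-cancelˡ-≤ (n ^ 3) _ _ (*-cancelˡ-≤ 4 (begin
    4 * (suc j * n ^ 3)                                       ≡⟨ *-assoc 4 (suc j) (n ^ 3) ⟨
    K * n ^ 3                                                 ≤⟨ *-monoʳ-≤ K (cubic-bound n l m mn≤ll n≤) ⟩
    K * (l ^ 5 + (3 * (l ^ 3 * n) + l * n ^ 2))               ≡⟨ expand K n l ⟩
    K * l ^ 5 + (3 * (K * l ^ 3 * n) + K * l * n ^ 2)
      ≤⟨ +-monoʳ-≤ (K * l ^ 5) (+-mono-≤ (*-monoʳ-≤ 3 (*-monoˡ-≤ n Kl³≤n²)) (*-monoˡ-≤ (n ^ 2) Kl≤n)) ⟩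
    K * l ^ 5 + (3 * (n ^ 2 * n) + n * n ^ 2)                 ≡⟨ collect j n (l ^ 5) ⟩
    4 * (n ^ 3 + suc j * l ^ 5)                               ∎))
    where
    open +-*-Solver
    expand : ∀ K n l → K * (l ^ 5 + (3 * (l ^ 3 * n) + l * n ^ 2)) ≡ K * l ^ 5 + (3 * (K * l ^ 3 * n) + K * l * n ^ 2)
    expand = solve 3 (λ K n l → K :* (l :^ 5 :+ (con 3 :* (l :^ 3 :* n) :+ l :* n :^ 2))
      := K :* l :^ 5 :+ (con 3 :* (K :* l :^ 3 :* n) :+ K :* l :* n :^ 2)) refl
    collect : ∀ j n x → 4 * suc j * x + (3 * (n ^ 2 * n) + n * n ^ 2) ≡ 4 * (n ^ 3 + suc j * x)
    collect = solve 3 (λ j n x → con 4 :* (con 1 :+ j) :* x :+ (con 3 :* (n :^ 2 :* n) :+ n :* n :^ 2)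
      := con 4 :* (n :^ 3 :+ (con 1 :+ j) :* x)) refl

-- Connected vertex transitive graphs

missed : ∀ {n k} (f : Fin k → Fin n) → k < n → ∃[ v ] ¬ Image f v
missed {n} f k<n = ¬∀⟶∃¬ n (Image f) (image? f) λ all →
  <⇒≱ k<n (injective⇒≤ {f = proj₁ ∘ all} λ {u} {v} eq →
    trans (proj₂ (all u)) (trans (cong f eq) (sym (proj₂ (all v)))))

module _ {n : ℕ} (G : Graph n) (connected : Connected G) where

  exit-edge : ∀ {k} (f : Fin (suc k) → Fin n) → suc k < n → ∃₂ λ u v → Image f u × ¬ Image f v × Edge G u v
  exit-edge f k<n with missed f k<n
  ... | y , y∉ = leave (connected (f zero) y) (zero , refl) y∉
    where
    leave : ∀ {a b} → Star (Edge G) a b → Image f a → ¬ Image f b → ∃₂ λ u v → Image f u × ¬ Image f v × Edge G u v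
    leave ε a∈ b∉ = ⊥-elim (b∉ a∈)
    leave (_◅_ {j = v} e es) a∈ b∉ with image? f v
    ... | yes v∈ = leave es v∈ b∉
    ... | no v∉  = _ , v , a∈ , v∉ , e

  connected-set : Fin n → ∀ k → k < n → ∃[ f ] (Injective _≡_ _≡_ f ×
    ∀ (i j : Fin (suc k)) → Walk (Edge G) (Image f) (f i) (f j))
  connected-set v₀ zero    _   = (λ _ → v₀) , (λ { {zero} {zero} _ → refl }) , (λ _ _ → stay (zero , refl))
  connected-set v₀ (suc k) k<n with connected-set v₀ k (<⇒≤ k<n)
  ... | f , f-inj , walk with exit-edge f k<n
  ...   | _ , y , (l , refl) , y∉ , e = y ◂ f , ◂-injective f-inj y∉ , walk'
    where
    old : ∀ {v} → Image f v → Image (y ◂ f) v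
    old (i , eq) = suc i , eq
    walk' : ∀ i j → Walk (Edge G) (Image (y ◂ f)) ((y ◂ f) i) ((y ◂ f) j)
    walk' zero    zero    = stay (zero , refl)
    walk' zero    (suc j) = go (zero , refl) (edge-sym G e) (map-walk id old (walk l j))
    walk' (suc i) zero    = map-walk id old (walk i l) ▷ go (suc l , refl) e (stay (zero , refl))
    walk' (suc i) (suc j) = map-walk id old (walk i j)

NonCut : ∀ {n} → Graph n → Fin n → Set
NonCut G x = ∀ {a b} → a ≢ x → b ≢ x → Walk (Edge G) (_≢ x) a b

-- A connected set grown to n - 1 vertices links everything except the one vertex it misses.
∃-noncut : ∀ {n} (G : Graph n) → Connected G → 2 ≤ n → ∃ (NonCut G)
∃-noncut {suc (suc k)} G connected (s≤s (s≤s _)) with connected-set G connected zero k (n≤1+n (suc k))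
... | f , f-inj , walk with missed f ≤-refl
...   | x , x∉ = x , λ a≢ b≢ → between (covered a≢) (covered b≢)
  where
  covered : ∀ {a} → a ≢ x → Image f a
  covered {a} a≢ with image? f a
  ... | yes a∈ = a∈
  ... | no a∉  = ⊥-elim (1+n≰n (injective⇒≤ (◂-injective (◂-injective f-inj x∉)
                   (λ { (zero , eq) → a≢ eq ; (suc i , eq) → a∉ (i , eq) }))))
  between : ∀ {a b} → Image f a → Image f b → Walk (Edge G) (_≢ x) a b
  between (i , refl) (j , refl) = map-walk id (λ { v∈ refl → x∉ v∈ }) (walk i j)

-- An automorphism taking `y` to `x` carries walks off `y` to walks off `x`.
noncut : ∀ {n} (G : Graph n) → Connected G → VertexTransitive G → 2 ≤ n → ∀ x → NonCut G x
noncut G connected transitive 2≤n x {a} {b} a≢ b≢ with ∃-noncut G connected 2≤n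
... | y , y-noncut with transitive y x
...   | π , π-aut , refl = subst₂ (Walk (Edge G) (_≢ (π ⟨$⟩ʳ y))) (inverseʳ π) (inverseʳ π)
  (push (y-noncut {π ⟨$⟩ˡ a} {π ⟨$⟩ˡ b} (pull a≢) (pull b≢)))
  where
  pull : ∀ {c} → c ≢ π ⟨$⟩ʳ y → π ⟨$⟩ˡ c ≢ y
  pull c≢ eq = c≢ (trans (sym (inverseʳ π)) (cong (π ⟨$⟩ʳ_) eq))
  push : ∀ {c d} → Walk (Edge G) (_≢ y) c d → Walk (Edge G) (_≢ (π ⟨$⟩ʳ y)) (π ⟨$⟩ʳ c) (π ⟨$⟩ʳ d)
  push (stay c≢)   = stay (c≢ ∘ ⟨$⟩ʳ-injective G {π} π-aut)
  push (go c≢ e w) = go (c≢ ∘ ⟨$⟩ʳ-injective G {π} π-aut) (trans (π-aut _ _) e) (push w)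

-- Lengthening a cycle by translates

module _ {n : ℕ} (G : Graph n) where

  translate : ∀ {L g} → IsAut G g → Cycle G L → Cycle G L
  translate {g = g} (g-inj , g-adj) C = record
    { len≥3 = len≥3
    ; vert  = g ∘ vert
    ; inj   = inj ∘ g-inj _ _
    ; step  = λ i j eq → trans (g-adj _ _) (step i j eq)
    ; close = λ i j eq eq' → trans (g-adj _ _) (close i j eq eq')
    }
    where open Cycle C

  coincidences≡0⇒≢ : ∀ {p q} (a : Fin p → Fin n) (b : Fin q → Fin n) → coincidences G a b ≡ 0 → ∀ i j → a i ≢ b j
  coincidences≡0⇒≢ a b ≡0 i j eq = <⇒≱ (s≤s z≤n) (begin
    1                             ≡⟨ 𝟙-true (a i ≟ b j) eq ⟨
    𝟙 (a i ≟ b j)                 ≤⟨ f≤sum (λ j → 𝟙 (a i ≟ b j)) j ⟩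
    sum (λ j → 𝟙 (a i ≟ b j))     ≤⟨ f≤sum (λ i → sum (λ j → 𝟙 (a i ≟ b j))) i ⟩
    coincidences G a b            ≡⟨ ≡0 ⟩
    0                             ∎)
    where open ≤-Reasoning

  coincidences≢0⇒∃≡ : ∀ {p q} (a : Fin p → Fin n) (b : Fin q → Fin n) → coincidences G a b ≢ 0 → ∃₂ λ i j → a i ≡ b j
  coincidences≢0⇒∃≡ a b ≢0 with 0<sum⇒∃0< (λ i → sum (λ j → 𝟙 (a i ≟ b j))) (n≢0⇒n>0 ≢0)
  ... | i , hi with 0<sum⇒∃0< (λ j → 𝟙 (a i ≟ b j)) hi
  ...   | j , hj with a i ≟ b j
  ...     | yes eq = i , j , eq
  ...     | no _   = ⊥-elim (n≮0 hj)

  -- The walk goes forward to index `toℕ j + L`, which is not before `toℕ i` whatever the order of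
  -- `i` and `j`.
  along-cycle : ∀ {L} (C : Cycle G L) {P : Fin n → Set} → (∀ i → P (Cycle.vert C i)) →
    ∀ i j → Walk (Edge G) P (Cycle.vert C i) (Cycle.vert C j)
  along-cycle {L} C {P} P-C i j = subst₂ (Walk (Edge G) P) (at-toℕ i)
    (trans (cong at (m+[n∸m]≡n (≤-trans (<⇒≤ (toℕ<n i)) (m≤n+m L (toℕ j))))) (trans (at-period (toℕ j)) (at-toℕ j)))
    (forward (toℕ i) ((toℕ j + L) ∸ toℕ i))
    where
    open Round C
    forward : ∀ k d → Walk (Edge G) P (at k) (at (k + d))
    forward k zero    = subst (λ l → Walk (Edge G) P (at k) (at l)) (sym (+-identityʳ k)) (stay (P-C _))
    forward k (suc d) = go (P-C _) (at-edge k)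
      (subst (λ l → Walk (Edge G) P (at (suc k)) (at l)) (sym (+-suc k d)) (forward (suc k) d))

  cycle-length≤ : ∀ {L} → Cycle G L → L ≤ n
  cycle-length≤ C = injective⇒≤ (Cycle.inj C)

  module _ (3≤n : 3 ≤ n) (connected : Connected G) (transitive : VertexTransitive G) where

    private
      no-cut : ∀ x → NonCut G x
      no-cut = noncut G connected transitive (<⇒≤ 3≤n)

    disjoint-cycles⇒longer : ∀ {L} (C D : Cycle G L) → coincidences G (Cycle.vert C) (Cycle.vert D) ≡ 0 → Longer G L
    disjoint-cycles⇒longer {L} C D m≡0 =
      [ id , ⊥-elim ∘ cut-vertex ∘ subst Separated m≡0 ]′ (longer-or-separated G C D)
      where
      Separated : ℕ → Set
      Separated m = Σ (Fin (m + suc m * suc m) → Fin n) (Separates (Edge G) (Round.On C) (Round.On D))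
      other : (C : Cycle G L) → ∀ x → ∃[ k ] Round.at C k ≢ x
      other C x with Round.at C 0 ≟ x
      ... | no ≢x    = 0 , ≢x
      ... | yes refl = 1 , ≢-sym (Round.at-window C (s≤s z≤n) (<⇒≤ (Cycle.len≥3 C)))
      -- For `m = 0` the size `m + suc m * suc m` is 1, so `S` is a single vertex, and each cycle
      -- has a vertex other than it.
      cut-vertex : ¬ Separated 0
      cut-vertex (S , S-sep) = S-sep (Round.at-on C (proj₁ i)) (Round.at-on D (proj₁ j))
        (map-walk id (λ { v≢ (zero , eq) → v≢ eq }) (no-cut (S zero) (proj₂ i) (proj₂ j)))
        where
        i = other C (S zero)
        j = other D (S zero)

    -- If `E` met both `C` and `D`, walking along it would join them off `S`. So it is disjoint from
    -- one of them.
    avoiding-cycle⇒longer : ∀ {L k} (C D E : Cycle G L) {S : Fin k → Fin n} →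
      Separates (Edge G) (Round.On C) (Round.On D) S → coincidences G (Cycle.vert E) S ≡ 0 → Longer G L
    avoiding-cycle⇒longer {L} C D E {S} S-sep avoids
      with coincidences G (Cycle.vert E) (Cycle.vert C) ℕ.≟ 0 | coincidences G (Cycle.vert E) (Cycle.vert D) ℕ.≟ 0
    ... | yes ≡0 | _      = disjoint-cycles⇒longer E C ≡0
    ... | no _   | yes ≡0 = disjoint-cycles⇒longer E D ≡0
    ... | no ≢C  | no ≢D  = ⊥-elim (both (coincidences≢0⇒∃≡ (Cycle.vert E) (Cycle.vert C) ≢C)
                                         (coincidences≢0⇒∃≡ (Cycle.vert E) (Cycle.vert D) ≢D))
      where
      both : (∃₂ λ i j → Cycle.vert E i ≡ Cycle.vert C j) → (∃₂ λ i j → Cycle.vert E i ≡ Cycle.vert D j) → ⊥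
      both (i , j , eq) (i' , j' , eq') = S-sep (j , eq) (j' , eq')
        (along-cycle E (λ { l (s , e) → coincidences≡0⇒≢ (Cycle.vert E) S avoids l s e }) i i')

    longer-or-bound : ∀ {L} → Cycle G L → Longer G L ⊎ ∃[ m ] (m * n ≤ L * L × n ≤ (m + suc m * suc m) * L)
    longer-or-bound {L} C = sparse (sparse-translate G transitive (Cycle.vert C) (Cycle.vert C))
      where
      Goal : Set
      Goal = Longer G L ⊎ ∃[ m ] (m * n ≤ L * L × n ≤ (m + suc m * suc m) * L)

      missing : ∀ {k} (D : Cycle G L) (S : Fin k → Fin n) → Separates (Edge G) (Round.On D) (Round.On C) S →
        k * L < n → (∃[ h ] (IsAut G h × coincidences G (h ∘ Cycle.vert C) S * n ≤ L * k)) → Longer G L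
      missing {k} D S S-sep kL<n (h , h-aut , few) = avoiding-cycle⇒longer D C (translate h-aut C) S-sep
        -- The count of coincidences times `n` is at most `L * k < n`, so the count is 0.
        (n<1⇒n≡0 (*-cancelʳ-< n _ 1 (≤-<-trans few (subst₂ _<_ (*-comm k L) (sym (*-identityˡ n)) kL<n))))

      sparse : (∃[ g ] (IsAut G g × coincidences G (g ∘ Cycle.vert C) (Cycle.vert C) * n ≤ L * L)) → Goal
      sparse (g , g-aut , m-bound) = [ inj₁ , separated ]′ (longer-or-separated G (translate g-aut C) C)
        where
        m = coincidences G (g ∘ Cycle.vert C) (Cycle.vert C)
        separated : Σ (Fin (m + suc m * suc m) → Fin n)
                      (Separates (Edge G) (Round.On (translate g-aut C)) (Round.On C)) → Goal
        separated (S , S-sep) =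
          [ (λ n≤ → inj₂ (m , m-bound , n≤))
          , (λ sL<n → inj₁ (missing (translate g-aut C) S S-sep sL<n (sparse-translate G transitive (Cycle.vert C) S)))
          ]′ (≤-<-connex n ((m + suc m * suc m) * L))

    -- No cycle is longer than `n`, and each lengthening pays for one unit of `fuel`.
    bounded-cycle : ∀ fuel {L} → Cycle G L → n < L + fuel →
      ∃[ L ] (Cycle G L × ∃[ m ] (m * n ≤ L * L × n ≤ (m + suc m * suc m) * L))
    bounded-cycle zero       C n< = ⊥-elim (<⇒≱ n< (subst (_≤ n) (sym (+-identityʳ _)) (cycle-length≤ C)))
    bounded-cycle (suc fuel) {L} C n< =
      [ (λ (L' , L<L' , C') → bounded-cycle fuel C'
            (<-≤-trans (subst (n <_) (+-suc L fuel) n<) (+-monoˡ-≤ fuel L<L')))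
      , (λ bound → L , C , bound)
      ]′ (longer-or-bound C)

    -- As `x` is no cut vertex, a path from `y` to `z` avoids it and closes up through `x`.
    cycle-through : ∀ {x y z} → Edge G x y → Edge G x z → y ≢ z → ∃ (Cycle G)
    cycle-through {x} {y} {z} xy xz y≢z =
      [ (λ (v , v≡y , v≡z , _) → ⊥-elim (y≢z (trans (sym v≡y) v≡z))) , close-up ]′
      (walk⇒bridge (_≟ y) (_≟ z) refl refl (no-cut x (≢x xy) (≢x xz)))
      where
      ≢x : ∀ {v} → Edge G x v → v ≢ x
      ≢x e refl with () ← trans (sym e) (irrefl G x)
      long : ∀ {xs} → Trail (Edge G) y xs z → 3 ≤ length ((y ∷ xs) ∷ʳ x)
      long []               = ⊥-elim (y≢z refl)
      long {_ ∷ xs} (_ ∷ t) = s≤s (s≤s (subst (1 ≤_) (sym (length-++ xs)) (m≤n+m 1 (length xs))))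
      close-up : Bridge (Edge G) (_≡ y) (_≡ z) (_≢ x) → ∃ (Cycle G)
      close-up record { trail = t ; unique = uniq ; uses = ≢x ; src∈ = refl ; tgt∈ = refl } =
        _ , closed-trail⇒cycle {G = G} ((xy ∷ t) ∷ʳᵗ edge-sym G xz)
          (++⁺ uniq ([] ∷ []) (λ { (v∈ , here refl) → All.lookup ≢x v∈ refl })) (long t)

    -- An edge leaving the two ends of a first edge shares one end with it, which gives a vertex
    -- with two neighbours.
    ∃-cycle : ∃ (Cycle G)
    ∃-cycle = first (exit-edge G connected {0} (λ _ → fromℕ< 3≤n) (<⇒≤ 3≤n))
      where
      second : ∀ {x y} → Edge G x y →
        (∃₂ λ u z → Image (x ◂ λ _ → y) u × ¬ Image (x ◂ λ _ → y) z × Edge G u z) → ∃ (Cycle G)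
      second xy (_ , z , (zero , refl)     , z∉ , xz) = cycle-through xy xz (λ y≡z → z∉ (suc zero , sym y≡z))
      second xy (_ , z , (suc zero , refl) , z∉ , yz) = cycle-through (edge-sym G xy) yz (λ x≡z → z∉ (zero , sym x≡z))
      first : {f : Fin 1 → Fin n} → (∃₂ λ x y → Image f x × ¬ Image f y × Edge G x y) → ∃ (Cycle G)
      first (x , y , _ , _ , xy) = second xy (exit-edge G connected (x ◂ λ _ → y) 3≤n)

-- The inequality is L ≥ (1 - 1/k) n^(3/5), raised to the fifth power and cleared of denominators,
-- so for each k the loss f(n) is at most 1/k from `N` on. Below the threshold f(n) = 1 suffices, as
-- a cycle is given for every n ≥ 3.
theorem4 : ∀ (k : ℕ) → 1 ≤ k → ∃[ N ] (∀ (n : ℕ) → 3 ≤ n → (G : Graph n) → Connected G → VertexTransitive G → ∃[ L ] (Cycle G L × (N ≤ n → (k ∸ 1) ^ 5 * n ^ 3 ≤ k ^ 5 * L ^ 5)))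
theorem4 (suc j) _ = (4 * suc j) ^ 5 , λ n 3≤n G connected transitive →
  conclude n G (grow n 3≤n G connected transitive (∃-cycle G 3≤n connected transitive))
  where
  Bounded : ∀ n → Graph n → Set
  Bounded n G = ∃[ L ] (Cycle G L × ∃[ m ] (m * n ≤ L * L × n ≤ (m + suc m * suc m) * L))

  grow : ∀ n → 3 ≤ n → (G : Graph n) → Connected G → VertexTransitive G → ∃ (Cycle G) → Bounded n G
  -- Fuel `suc n` satisfies `n < L + fuel` for every starting length.
  grow n 3≤n G connected transitive (L , C) = bounded-cycle G 3≤n connected transitive (suc n) C (m≤n+m (suc n) L)

  conclude : ∀ n (G : Graph n) → Bounded n G →
    ∃[ L ] (Cycle G L × ((4 * suc j) ^ 5 ≤ n → j ^ 5 * n ^ 3 ≤ suc j ^ 5 * L ^ 5))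
  conclude n G (L , C , m , m-bound , n-bound) = L , C , λ N≤n → length-bound j n L m N≤n m-bound n-bound
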